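{- Suppose that the Erdős–Sós conjecture holds for all trees, i.e., for every integer $\ell\ge 1$, every tree $S$ on $\ell+1$ vertices and every positive integer $n$, we have $\mathrm{ex}(n,S)\le \frac{\ell-1}{2}n$. Let $k\ge 1$ and $r\ge 2$ be integers, let $T$ be a tree on $k+1$ vertices and let $n$ be a positive integer. If $k > r+1>3$, then \[ \mathrm{ex}_r(n,\text{Berge- }T) \leq \frac{n}{k}\binom{k}{r}, \] and moreover, if $k$ divides $n$, this bound is sharp (i.e., equality holds). If $k \leq r+1$, then \[ \mathrm{ex}_r(n,\text{Berge- }T) \leq \frac{k-1}{2}n. \]
   Context: All graphs and hypergraphs are finite and simple. A hypergraph $\mathcal{H}$ contains a Berge-$F$ (Berge copy of the graph $F$) if there are an injection $\varphi:V(F)\to V(\mathcal{H})$ and an injection $f:E(F)\to E(\mathcal{H})$ with $\{\varphi(u),\varphi(v)\}\subset f(uv)$ for every edge $uv\in E(F)$; otherwise it is Berge-$F$-free. $\mathrm{ex}_r(n,\text{Berge- }F)$ is the maximum number of hyperedges in an $n$-vertex $r$-uniform Berge-$F$-free hypergraph. $\mathrm{ex}(n,F)$ is the maximum number of edges in an $n$-vertex graph with no (not necessarily induced) subgraph isomorphic to $F$. -}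

module Defs where

open import Data.Bool.Properties using () renaming (_≟_ to _≟ᵇ_)
open import Data.Fin using (Fin; zero; suc; combine; fromℕ; inject₁)
open import Data.Fin.Properties
  using (all?; any?; combine-injective; injective⇒≤) renaming (_≟_ to _≟ᶠ_)
open import Data.Fin.Subset
  using (Subset; inside; outside; _∪_; ⁅_⁆; ∣_∣) renaming (_⊆_ to _⊆ˢ_)
open import Data.Fin.Subset.Properties using (anySubset?; _⊆?_)
open import Data.List using (List; []; _∷_; length; lookup)
open import Data.List.Membership.DecPropositional using (_∈?_)
open import Data.List.Relation.Unary.Unique.DecPropositional using (unique?)
open import Data.List.Membership.Propositional using (_∈_)
open import Data.List.Membership.Propositional.Properties using (∈-lookup)
open import Data.List.Relation.Unary.All as All using (All)
open import Data.List.Relation.Unary.AllPairs using (_∷_)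
open import Data.List.Relation.Unary.Unique.Propositional using (Unique)
open import Data.Nat
  using (ℕ; zero; suc; _+_; _*_; _∸_; _^_; _≤_; z≤n; s≤s)
open import Data.Nat.Properties using (≤-refl; ≤∧≢⇒<; suc-injective)
  renaming (_≟_ to _≟ⁿ_)
open import Data.Product using (Σ; ∃; ∃₂; _×_; _,_; proj₁; proj₂)
open import Data.Vec using ([]; _∷_)
open import Data.Vec.Properties using (≡-dec)
open import Function using (_∘_; Injective)
open import Relation.Binary.Construct.Closure.ReflexiveTransitive using (Star)
open import Relation.Binary.Definitions using (DecidableEquality)
open import Relation.Binary.PropositionalEquality
  using (_≡_; _≢_; refl; sym; trans; cong; subst; _≗_)
open import Relation.Nullary using (¬_; Dec; yes; no; contradiction)
open import Relation.Nullary.Decidable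
  using (map′; ¬?; _×-dec_; _→-dec_)
open import Relation.Unary using (Decidable)

private
  variable
    k m n p r : ℕ

_≟ˢ_ : DecidableEquality (Subset n)
_≟ˢ_ = ≡-dec _≟ᵇ_

-- r-uniform hypergraphs on the vertex set Fin n.  The hyperedges are
-- pairwise distinct; their order in the list carries no information.
record Hypergraph (r n : ℕ) : Set where
  constructor mkHypergraph
  field
    edges   : List (Subset n)
    unique  : Unique edges
    uniform : All (λ e → ∣ e ∣ ≡ r) edges

open Hypergraph public

size : Hypergraph r n → ℕ
size H = length (edges H)

E : Hypergraph r n → Set
E H = Fin (size H)

edge : (H : Hypergraph r n) → E H → Subset n
edge H = lookup (edges H)

Graph : ℕ → Set
Graph = Hypergraph 2

pair : Fin n → Fin n → Subset n
pair u v = ⁅ u ⁆ ∪ ⁅ v ⁆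

-- Irreflexive, because ∣ pair u u ∣ ≡ 1 while edges have two elements.
Adj : Graph n → Fin n → Fin n → Set
Adj G u v = pair u v ∈ edges G

Connected : Graph n → Set
Connected G = ∀ u v → Star (Adj G) u v

-- The index m encodes the length 3 + m, so cycles have length at least 3.
record Cycle (G : Graph n) (m : ℕ) : Set where
  field
    vertex    : Fin (3 + m) → Fin n
    injective : Injective _≡_ _≡_ vertex
    step      : ∀ i → Adj G (vertex (inject₁ i)) (vertex (suc i))
    close     : Adj G (vertex (fromℕ (2 + m))) (vertex zero)

Acyclic : Graph n → Set
Acyclic G = ∀ m → ¬ Cycle G m

-- Used only for graphs with at least one vertex.
IsTree : Graph n → Set
IsTree G = Connected G × Acyclic G

ContainsSubgraph : Graph p → Graph n → Set
ContainsSubgraph {p} {n} F G =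
  Σ (Fin p → Fin n) λ φ →
    Injective _≡_ _≡_ φ × (∀ u v → Adj F u v → Adj G (φ u) (φ v))

ContainsBerge : Graph p → Hypergraph r n → Set
ContainsBerge {p} {n = n} F H =
  Σ (Fin p → Fin n) λ φ → Injective _≡_ _≡_ φ ×
  Σ (E F → E H) λ f → Injective _≡_ _≡_ f ×
    (∀ e u v → edge F e ≡ pair u v → pair (φ u) (φ v) ⊆ˢ edge H (f e))

injective? : (f : Fin m → Fin n) → Dec (Injective _≡_ _≡_ f)
injective? f =
  map′ (λ g {x} {y} → g x y) (λ inj x y → inj {x} {y})
       (all? λ x → all? λ y → (f x ≟ᶠ f y) →-dec (x ≟ᶠ y))

injective-resp : {f g : Fin m → Fin n} → f ≗ g →
                 Injective _≡_ _≡_ f → Injective _≡_ _≡_ g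
injective-resp f≗g inj {x} {y} gx≡gy =
  inj (trans (f≗g x) (trans gx≡gy (sym (f≗g y))))

cons : Fin n → (Fin m → Fin n) → Fin (suc m) → Fin n
cons x f zero    = x
cons x f (suc i) = f i

anyFunction? : (P : (Fin m → Fin n) → Set) →
               (∀ {f g} → f ≗ g → P f → P g) → Decidable P → Dec (∃ P)
anyFunction? {zero} P resp P? =
  map′ (none ,_) (λ (f , p) → resp {g = none} (λ ()) p) (P? none)
  where
  none : Fin 0 → Fin _
  none ()
anyFunction? {suc m} P resp P? =
  map′ (λ (x , f , p) → cons x f , p)
       (λ (f , p) → f zero , f ∘ suc ,
         resp (λ { zero → refl ; (suc i) → refl }) p)
       (any? λ x → anyFunction? (P ∘ cons x)
         (λ f≗g → resp λ { zero → refl ; (suc i) → f≗g i })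
         (P? ∘ cons x))

adj? : (G : Graph n) (u v : Fin n) → Dec (Adj G u v)
adj? G u v = _∈?_ _≟ˢ_ (pair u v) (edges G)

containsSubgraph? : (F : Graph p) (G : Graph n) → Dec (ContainsSubgraph F G)
containsSubgraph? F G = anyFunction? _
  (λ { φ≗ψ (inj , hom) → injective-resp φ≗ψ inj ,
       λ u v uv → resp₂ (φ≗ψ u) (φ≗ψ v) (hom u v uv) })
  (λ φ → injective? φ ×-dec
    all? λ u → all? λ v → adj? F u v →-dec adj? G (φ u) (φ v))
  where
  resp₂ : ∀ {a b c d} → a ≡ b → c ≡ d → Adj G a c → Adj G b d
  resp₂ refl refl ac = ac

containsBerge? : (F : Graph p) (H : Hypergraph r n) → Dec (ContainsBerge F H)
containsBerge? F H = anyFunction? _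
  (λ { φ≗ψ (φ-inj , f , f-inj , sub) → injective-resp φ≗ψ φ-inj , f , f-inj ,
       λ e u v eq → resp₃ (φ≗ψ u) (φ≗ψ v) (refl {x = f e}) (sub e u v eq) })
  (λ φ → injective? φ ×-dec anyFunction? _
    (λ { f≗g (f-inj , sub) → injective-resp f≗g f-inj ,
         λ e u v eq → resp₃ (refl {x = φ u}) (refl {x = φ v}) (f≗g e)
                            (sub e u v eq) })
    (λ f → injective? f ×-dec
      all? λ e → all? λ u → all? λ v →
        (edge F e ≟ˢ pair u v) →-dec (pair (φ u) (φ v) ⊆? edge H (f e))))
  where
  resp₃ : ∀ {a b c d i j} → a ≡ b → c ≡ d → i ≡ j →
          pair a c ⊆ˢ edge H i → pair b d ⊆ˢ edge H j
  resp₃ refl refl refl s = s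

encode : Subset n → Fin (2 ^ n)
encode []            = zero
encode (outside ∷ s) = combine {2} zero (encode s)
encode (inside  ∷ s) = combine {2} (suc zero) (encode s)

encode-injective : Injective _≡_ _≡_ (encode {n})
encode-injective {x = []} {[]} _ = refl
encode-injective {x = outside ∷ s} {outside ∷ t} eq =
  cong (outside ∷_) (encode-injective
    (proj₂ (combine-injective {2} zero (encode s) zero (encode t) eq)))
encode-injective {x = inside ∷ s} {inside ∷ t} eq =
  cong (inside ∷_) (encode-injective
    (proj₂ (combine-injective {2} (suc zero) (encode s) (suc zero) (encode t) eq)))
encode-injective {x = outside ∷ s} {inside ∷ t} eq
  with () ← proj₁ (combine-injective {2} zero (encode s) (suc zero) (encode t) eq)
encode-injective {x = inside ∷ s} {outside ∷ t} eq
  with () ← proj₁ (combine-injective {2} (suc zero) (encode s) zero (encode t) eq)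

lookup-injective : {A : Set} {xs : List A} →
                   Unique xs → Injective _≡_ _≡_ (lookup xs)
lookup-injective (x∉ ∷ u) {zero}  {zero}  _  = refl
lookup-injective (x∉ ∷ u) {suc i} {suc j} eq = cong suc (lookup-injective u eq)
lookup-injective (x∉ ∷ u) {zero}  {suc j} eq =
  contradiction eq (All.lookup x∉ (∈-lookup j))
lookup-injective (x∉ ∷ u) {suc i} {zero}  eq =
  contradiction (sym eq) (All.lookup x∉ (∈-lookup i))

size≤ : (H : Hypergraph r n) → size H ≤ 2 ^ n
size≤ H = injective⇒≤ (lookup-injective (unique H) ∘ encode-injective)

greatest : {P : ℕ → Set} → Decidable P → ℕ → ℕ
greatest P? zero = zero
greatest P? (suc b) with P? (suc b)
... | yes _ = suc b
... | no  _ = greatest P? b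

greatest-max : {P : ℕ → Set} (P? : Decidable P) (b : ℕ) →
               m ≤ b → P m → m ≤ greatest P? b
greatest-max P? zero z≤n pm = z≤n
greatest-max {m = m} P? (suc b) m≤ pm with P? (suc b)
... | yes _ = m≤
... | no ¬p with s≤s m≤b ← ≤∧≢⇒< m≤ (λ { refl → ¬p pm }) =
  greatest-max P? b m≤b pm

greatest-holds : {P : ℕ → Set} (P? : Decidable P) (b : ℕ) →
                 m ≤ b → P m → P (greatest P? b)
greatest-holds P? zero z≤n pm = pm
greatest-holds {m = m} P? (suc b) m≤ pm with P? (suc b)
... | yes p = p
... | no ¬p with s≤s m≤b ← ≤∧≢⇒< m≤ (λ { refl → ¬p pm }) =
  greatest-holds P? b m≤b pm

anyList? : ∀ m (P : List (Subset n) → Set) → Decidable P →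
           Dec (∃ λ xs → length xs ≡ m × P xs)
anyList? zero P P? =
  map′ (λ p → [] , refl , p) (λ { ([] , _ , p) → p }) (P? [])
anyList? (suc m) P P? =
  map′ (λ (x , xs , eq , p) → x ∷ xs , cong suc eq , p)
       (λ { (x ∷ xs , eq , p) → x , xs , suc-injective eq , p })
       (anySubset? λ x → anyList? m (P ∘ (x ∷_)) (P? ∘ (x ∷_)))

module Extremal
  (r n : ℕ)
  (Contains : Hypergraph r n → Set)
  (contains? : Decidable Contains)
  (resp : ∀ H H′ → edges H ≡ edges H′ → Contains H → Contains H′)
  where

  FreeOfSize : ℕ → Set
  FreeOfSize m = ∃ λ H → size H ≡ m × ¬ Contains H

  private
    Free : List (Subset n) → Set
    Free es = ∃₂ λ u a → ¬ Contains (mkHypergraph es u a)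

    free? : Decidable Free
    free? es with unique? _≟ˢ_ es | All.all? (λ e → ∣ e ∣ ≟ⁿ r) es
    ... | no ¬u | _     = no λ (u , _) → ¬u u
    ... | _     | no ¬a = no λ (_ , a , _) → ¬a a
    ... | yes u | yes a =
      map′ (λ ¬c → u , a , ¬c) (λ (_ , _ , ¬c) c → ¬c (resp _ _ refl c))
           (¬? (contains? (mkHypergraph es u a)))

  freeOfSize? : Decidable FreeOfSize
  freeOfSize? m =
    map′ (λ (es , eq , u , a , ¬c) → mkHypergraph es u a , eq , ¬c)
         (λ (H , eq , ¬c) → edges H , eq , unique H , uniform H , ¬c)
         (anyList? m Free free?)

  -- The maximum size of a hypergraph H with ¬ Contains H.  It is 0 if
  -- there is no such H; this does not occur when Contains fails for the
  -- hypergraph without hyperedges.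
  ex : ℕ
  ex = greatest freeOfSize? (2 ^ n)

  ex-max : ∀ H → ¬ Contains H → size H ≤ ex
  ex-max H ¬c = greatest-max freeOfSize? (2 ^ n) (size≤ H) (H , refl , ¬c)

  ex-attained : ∀ H → ¬ Contains H → FreeOfSize ex
  ex-attained H ¬c =
    greatest-holds freeOfSize? (2 ^ n) (size≤ H) (H , refl , ¬c)

subgraph-resp : (F : Graph p) (G G′ : Graph n) → edges G ≡ edges G′ →
                ContainsSubgraph F G → ContainsSubgraph F G′
subgraph-resp F (mkHypergraph _ _ _) (mkHypergraph _ _ _) refl c = c

berge-resp : (F : Graph p) (H H′ : Hypergraph r n) → edges H ≡ edges H′ →
             ContainsBerge F H → ContainsBerge F H′
berge-resp F (mkHypergraph _ _ _) (mkHypergraph _ _ _) refl c = c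

module Turán {p} (n : ℕ) (F : Graph p) =
  Extremal 2 n (ContainsSubgraph F) (containsSubgraph? F) (subgraph-resp F)

module BergeTurán {p} (r n : ℕ) (F : Graph p) =
  Extremal r n (ContainsBerge F) (containsBerge? F) (berge-resp F)

ex : (n : ℕ) → Graph p → ℕ
ex n F = Turán.ex n F

exBerge : (r n : ℕ) → Graph p → ℕ
exBerge r n F = BergeTurán.ex r n F

-- ex(n, S) ≤ (ℓ - 1) / 2 · n with the denominator cleared; ∸ is exact as 1 ≤ ℓ.
ErdősSós : Set
ErdősSós =
  ∀ ℓ → 1 ≤ ℓ → (S : Graph (suc ℓ)) → IsTree S →
  ∀ n → 1 ≤ n → 2 * ex n S ≤ (ℓ ∸ 1) * n

module Submission where

-- In the incidence relation between hyperedges and the pairs they contain,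
-- König's theorem yields a matching whose pairs form a T-free graph with red
-- and blue edges, such that every hyperedge not matched to a red pair has all
-- its pairs blue.  So H has at most as many hyperedges as there are red edges
-- and blue r-cliques.  Cliques through a vertex v live in the neighbourhood of
-- v, which contains no copy of T minus a leaf; induction with the Erdős–Sós
-- bound on the number of edges therefore bounds the blue r-cliques by
-- 2 C(k-1,r-1) / (r (k-1)) per blue edge.  This factor is at least 1 if
-- k > r + 1 and at most 1 otherwise.  Disjoint complete r-uniform hypergraphs
-- on k vertices show sharpness.

open import Defs
import Algebra.Solver.CommutativeMonoid as CMSolver
open import Data.Empty using (⊥-elim)
open import Data.Fin
  using ( Fin; zero; suc; toℕ; punchIn; punchOut; combine
        ; quotient; remQuot; remainder; splitAt )
open import Data.Fin.Properties
  using ( any?; all?; ¬Fin0; injective⇒≤; punchIn-injective; punchInᵢ≢i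
        ; punchIn-punchOut; punchOut-punchIn; punchOut-injective; punchOut-cong′
        ; pigeonhole; toℕ-injective; toℕ-inject₁; toℕ-fromℕ; toℕ<n; combine-remQuot )
  renaming (_≟_ to _≟ᶠ_; suc-injective to Fin-suc-injective)
open import Data.Fin.Subset
  using (Subset; inside; outside; ⊥; ∣_∣; ⁅_⁆; _-_)
  renaming (_∈_ to _∈ˢ_; _∉_ to _∉ˢ_; _⊆_ to _⊆ˢ_)
open import Data.Fin.Subset.Properties
  using ( anySubset?; drop-there; ⊆-antisym; p⊆q⇒∣p∣≤∣q∣; p⊂q⇒∣p∣<∣q∣; ∣⊥∣≡0
        ; ∪-comm; ∪-idem; ∪-identityˡ; ∪-identityʳ; x∈p∪q⁺; x∈p∪q⁻
        ; x∈⁅x⁆; x∈⁅y⁆⇒x≡y; ∣⁅x⁆∣≡1; p─⊥≡p; p─q⊆p; x∈p∧x≢y⇒x∈p-y )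
  renaming (_∈?_ to _∈ˢ?_; _⊆?_ to _⊆ˢ?_)
open import Data.List using (List; []; _∷_; [_]; _++_; length; filter; map; lookup)
open import Data.List.Membership.DecPropositional using (_∈?_)
open import Data.List.Membership.Propositional using (_∈_)
open import Data.List.Membership.Propositional.Properties
  using ( ∈-∃++; ∈-++⁺ˡ; ∈-++⁺ʳ; ∈-++⁻; ∈-map⁺; ∈-map⁻; ∈-filter⁺; ∈-filter⁻
        ; ∈-lookup )
open import Data.List.Properties
  using (length-++; length-map; map-++; ++-assoc; ++-identityʳ)
open import Data.List.Relation.Binary.Permutation.Propositional
  using ( _↭_; ↭-refl; ↭-sym; ↭-trans; ↭-reflexive; prep; ↭⇒↭ₛ
        ; module PermutationReasoning )
open import Data.List.Relation.Binary.Permutation.Propositional.Properties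
  using (All-resp-↭; ∈-resp-↭; shift; ++⁺ʳ; ++-commutativeMonoid; ↭-length)
  renaming (map⁺ to ↭-map⁺)
import Data.List.Relation.Binary.Permutation.Setoid.Properties as ↭ₛ
open import Data.List.Relation.Unary.All as All using (All; []; _∷_)
import Data.List.Relation.Unary.All.Properties as All
open import Data.List.Relation.Unary.AllPairs using ([]; _∷_)
open import Data.List.Relation.Unary.Any using (here; there; index)
open import Data.List.Relation.Unary.Any.Properties using (lookup-index)
open import Data.List.Relation.Unary.Unique.Propositional using (Unique)
import Data.List.Relation.Unary.Unique.Propositional.Properties as Unique
open import Data.Nat
  using (ℕ; zero; suc; _+_; _*_; _∸_; _≤_; _<_; z≤n; s≤s; s≤s⁻¹)
open import Data.Nat.Combinatorics
  using ( _C_; nCn≡1; nC1≡n; nCk≡nC[n∸k]; nCk+nC[k+1]≡[n+1]C[k+1]; k>n⇒nCk≡0 )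
open import Data.Nat.Divisibility using (_∣_; divides)
open import Data.Nat.Induction using (<-rec)
import Data.Nat.Properties as ℕ
open import Data.Nat.Tactic.RingSolver using (solve-∀)
open import Data.Product using (Σ; ∃; ∃₂; _×_; _,_; proj₁; proj₂; uncurry)
open import Data.Sum using (_⊎_; inj₁; inj₂; [_,_]′)
open import Data.Vec using ([]; _∷_; here; there; tabulate) renaming (_++_ to _++ᵛ_)
open import Data.Vec.Properties
  using ( ∷-injectiveʳ; ++-injectiveˡ; ++-injectiveʳ; lookup∘tabulate
        ; lookup-splitAt; lookup-replicate; lookup⇒[]=; []=⇒lookup )
open import Function using (_∘_; Injective)
open import Relation.Binary.Construct.Closure.ReflexiveTransitive
  using (Star; ε; _◅_)
open import Relation.Binary.Definitions using (DecidableEquality; tri<; tri≈; tri>)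
open import Relation.Binary.PropositionalEquality
  using ( _≡_; _≢_; refl; sym; trans; cong; cong₂; subst; subst₂; setoid
        ; module ≡-Reasoning )
open import Relation.Nullary using (¬_; Dec; yes; no; does; contradiction)
open import Relation.Nullary.Decidable
  using (_×-dec_; _→-dec_; ¬?; dec-true; decidable-stable)

open import Algebra.Properties.Semiring.Sum ℕ.+-*-semiring
  using ( sum; sum-cong-≗; ∑-distrib-+; *-distribˡ-sum; *-distribʳ-sum
        ; sum-replicate-zero )

-- The blue cliques have to be counted per blue edge and not per vertex, because Erdős-Sós bounds
-- only the red and blue edges together, by (k-1)n/2, and a separate bound in n for the cliques
-- would add to it. With the weight w = 2 C(k-1,r-1) / (r (k-1)) there are at most red + w blue
-- hyperedges, hence at most max(1,w) (k-1)n/2. If w is at least 1, this is (n/r) C(k-1,r-1) = (n/k)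
-- C(k,r); otherwise it is (k-1)n/2.
--
-- The weight arises by counting each r-clique at its r vertices: by induction a vertex v lies in at
-- most d(v) C(k-1,r-1) / (k-1) of them, and the degrees sum to twice the number of edges. Each
-- passage to a neighbourhood prunes the tree, so Erdős-Sós is applied to smaller trees as well as
-- to T. All inequalities have their denominators cleared.

private
  variable
    k m n p q r : ℕ

-- König's theorem

Unique-resp-↭ : {A : Set} {xs ys : List A} → xs ↭ ys → Unique xs → Unique ys
Unique-resp-↭ p = ↭ₛ.Unique-resp-↭ (setoid _) (↭⇒↭ₛ p)

-- Matchings are lists of pairs, built by inserting the elements of A one at a
-- time; the blue part of B is a vertex cover together with the red part of A.
module König
  {A B : Set} (_≟_ : DecidableEquality B) (Rel : A → B → Set)
  (escape : ∀ a R → (∃ λ b → Rel a b × ¬ b ∈ R) ⊎ (∀ {b} → Rel a b → b ∈ R))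
  where

  left : List (A × B) → List A
  left = map proj₁

  right : List (A × B) → List B
  right = map proj₂

  Related : List (A × B) → Set
  Related = All (uncurry Rel)

  -- Only the matched elements of `A` persist; their partners may all change, as long as they avoid
  -- the forbidden list `R`.
  Enlarged : List (A × B) → A → List B → Set
  Enlarged M a R = ∃ λ M′ →
    left M′ ↭ a ∷ left M × Related M′ × Unique (right M′ ++ R)

  -- A Hall-type obstruction: outside `R`, the elements `a ∷ left M₂` have only the partners
  -- occurring in `M₂`, one too few.
  Blocked : List (A × B) → A → List B → Set
  Blocked M a R = ∃₂ λ M₁ M₂ → M ↭ M₁ ++ M₂ ×
    (∀ {x b} → x ∈ a ∷ left M₂ → Rel x b → b ∈ right M₂ ++ R)

  private
    split-at : ∀ {M} {p : A × B} → p ∈ M → ∃ λ M₀ → M ↭ p ∷ M₀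
    split-at {p = p} p∈M with ∈-∃++ p∈M
    ... | xs , ys , refl = xs ++ ys , shift p xs ys

    right-++ : ∀ M M′ R → right (M ++ M′) ++ R ↭ right M ++ (right M′ ++ R)
    right-++ M M′ R =
      ↭-trans (↭-reflexive (cong (_++ R) (map-++ proj₂ M M′)))
              (↭-reflexive (++-assoc (right M) (right M′) R))

    right-resp : ∀ {M N} R → M ↭ N → Unique (right M ++ R) → Unique (right N ++ R)
    right-resp R M↭N = Unique-resp-↭ (++⁺ʳ R (↭-map⁺ proj₂ M↭N))

  -- An alternating search from a that avoids R.  When a → b meets the
  -- partner x of b, first try to move x elsewhere; if that is blocked by M₂,
  -- everything M₂ is matched to is added to R and the search from a goes on.
  augment : ∀ m M a R → length M ≤ m → Related M → Unique (right M ++ R) →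
            Enlarged M a R ⊎ Blocked M a R
  augment m M a R M≤m rel uniq with escape a R
  ... | inj₂ closed = inj₂ (M , [] , ↭-sym (↭-reflexive (++-identityʳ M)) ,
                            λ { (here refl) → closed })
  ... | inj₁ (b , ab , b∉R) with _∈?_ _≟_ b (right M)
  ... | no b∉M = inj₁ ((a , b) ∷ M , ↭-refl , ab ∷ rel ,
                       All.¬Any⇒All¬ _ ([ b∉M , b∉R ]′ ∘ ∈-++⁻ (right M)) ∷ uniq)
  ... | yes b∈M with ∈-map⁻ proj₂ b∈M
  ... | (x , .b) , xb∈M , refl with split-at xb∈M
  -- `m` bounds the length of the matching. Both recursive calls work without the pair `(x , b)`, so
  -- the bound drops by one.
  ... | M₀ , M↭ with m | M≤m | ↭-length M↭
  ... | zero | M≤0 | eq with () ← subst (_≤ 0) eq M≤0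
  ... | suc m | M≤ | eq with subst (_≤ suc m) eq M≤ | All-resp-↭ M↭ rel
  ... | s≤s M₀≤m | xb ∷ rel₀ with augment m M₀ x (b ∷ R) M₀≤m rel₀
                                  (Unique-resp-↭ (↭-sym (shift b (right M₀) R))
                                    (right-resp R M↭ uniq))
  ... | inj₁ (M′ , left↭ , rel′ , uniq′) =
    inj₁ ((a , b) ∷ M′ ,
          prep a (↭-trans left↭ (↭-sym (↭-map⁺ proj₁ M↭))) ,
          ab ∷ rel′ ,
          Unique-resp-↭ (shift b (right M′) R) uniq′)
  ... | inj₂ (M₁ , M₂ , M₀↭ , closed)
    with augment m M₁ a (right ((x , b) ∷ M₂) ++ R)
           (ℕ.≤-trans (ℕ.m≤m+n (length M₁) (length M₂))
             (subst (_≤ m) (trans (↭-length M₀↭) (length-++ M₁)) M₀≤m))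
           (proj₁ (All.++⁻ M₁ (All-resp-↭ M₀↭ rel₀)))
           (Unique-resp-↭ (right-++ M₁ ((x , b) ∷ M₂) R)
             (right-resp R (↭-trans M↭ (↭-trans (prep _ M₀↭)
               (↭-sym (shift (x , b) M₁ M₂)))) uniq))
  ... | inj₁ (M′ , left↭ , rel′ , uniq′) =
    inj₁ (M′ ++ (x , b) ∷ M₂ ,
          (begin
            left (M′ ++ (x , b) ∷ M₂)      ≡⟨ map-++ proj₁ M′ _ ⟩
            left M′ ++ x ∷ left M₂         ↭⟨ ++⁺ʳ _ left↭ ⟩
            a ∷ (left M₁ ++ x ∷ left M₂)   ↭⟨ prep a (shift x (left M₁) (left M₂)) ⟩
            a ∷ x ∷ (left M₁ ++ left M₂)   ≡⟨ cong (λ z → a ∷ x ∷ z) (map-++ proj₁ M₁ M₂) ⟨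
            a ∷ x ∷ left (M₁ ++ M₂)        ↭⟨ prep a (↭-map⁺ proj₁ (↭-trans M↭ (prep _ M₀↭))) ⟨
            a ∷ left M                     ∎) ,
          All.++⁺ rel′ (xb ∷ proj₂ (All.++⁻ M₁ (All-resp-↭ M₀↭ rel₀))) ,
          Unique-resp-↭ (↭-sym (right-++ M′ ((x , b) ∷ M₂) R)) uniq′)
    where open PermutationReasoning
  ... | inj₂ (M₃ , M₄ , M₁↭ , closed′) =
    inj₂ (M₃ , M₄ ++ (x , b) ∷ M₂ ,
          (begin
            M                              ↭⟨ ↭-trans M↭ (prep _ M₀↭) ⟩
            (x , b) ∷ M₁ ++ M₂             ↭⟨ shift (x , b) M₁ M₂ ⟨
            M₁ ++ (x , b) ∷ M₂             ↭⟨ ++⁺ʳ _ M₁↭ ⟩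
            (M₃ ++ M₄) ++ (x , b) ∷ M₂     ≡⟨ ++-assoc M₃ M₄ _ ⟩
            M₃ ++ M₄ ++ (x , b) ∷ M₂       ∎) ,
          closed″)
    where
    open PermutationReasoning
    Q = (x , b) ∷ M₂
    from-M₂ : ∀ {y c} → y ∈ left Q → Rel y c → c ∈ right (M₄ ++ Q) ++ R
    from-M₂ {y} {c} y∈ yc = ∈-resp-↭ (↭-sym (right-++ M₄ Q R))
      (∈-++⁺ʳ (right M₄) (∈-resp-↭ (shift b (right M₂) R) (closed y∈ yc)))
    closed″ : ∀ {y c} → y ∈ a ∷ left (M₄ ++ Q) → Rel y c →
              c ∈ right (M₄ ++ Q) ++ R
    closed″ {y} {c} y∈ yc
      with ∈-++⁻ (a ∷ left M₄) (subst (y ∈_) (cong (a ∷_) (map-++ proj₁ M₄ Q)) y∈)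
    ... | inj₁ y∈M₄ = ∈-resp-↭ (↭-sym (right-++ M₄ Q R)) (closed′ y∈M₄ yc)
    ... | inj₂ y∈Q  = from-M₂ y∈Q yc

  record Decomposition (as : List A) : Set where
    field
      red blue : List (A × B)
      rest     : List A
      cover    : as ↭ left red ++ left blue ++ rest
      red-rel  : Related red
      blue-rel : Related blue
      distinct : Unique (right red ++ right blue)
      closed   : ∀ {a b} → a ∈ left blue ++ rest → Rel a b → b ∈ right blue

  decompose : ∀ as → Decomposition as
  decompose [] = record
    { red = [] ; blue = [] ; rest = [] ; cover = ↭-refl ; red-rel = []
    ; blue-rel = [] ; distinct = [] ; closed = λ () }
  decompose (a ∷ as) with decompose as
  ... | record { red = red ; blue = blue ; rest = rest ; cover = cover
               ; red-rel = red-rel ; blue-rel = blue-rel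
               ; distinct = distinct ; closed = closed }
    -- Forbidding `right blue` leaves the blue part untouched, so `closed` survives a successful
    -- search.
    with augment (length red) red a (right blue) ℕ.≤-refl red-rel distinct
  ... | inj₁ (red′ , left↭ , rel′ , uniq′) = record
    { red = red′ ; blue = blue ; rest = rest
    ; cover = ↭-trans (prep a cover) (++⁺ʳ _ (↭-sym left↭))
    ; red-rel = rel′ ; blue-rel = blue-rel ; distinct = uniq′ ; closed = closed }
  -- The obstruction `M₄` turns from red to blue. Then all neighbours of its left ends and of `a`
  -- are blue, so `a` can stay unmatched.
  ... | inj₂ (M₃ , M₄ , red↭ , closed′) = record
    { red = M₃ ; blue = M₄ ++ blue ; rest = a ∷ rest
    ; cover = begin
        a ∷ as
          ↭⟨ prep a cover ⟩
        a ∷ (left red ++ left blue ++ rest)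
          ↭⟨ prep a (++⁺ʳ _ (↭-map⁺ proj₁ red↭)) ⟩
        a ∷ (left (M₃ ++ M₄) ++ left blue ++ rest)
          ≡⟨ cong (λ z → a ∷ z ++ _) (map-++ proj₁ M₃ M₄) ⟩
        a ∷ ((left M₃ ++ left M₄) ++ left blue ++ rest)
          ↭⟨ solve 5 (λ v w x y z → v ⊕ ((w ⊕ x) ⊕ (y ⊕ z)) ⊜ w ⊕ ((x ⊕ y) ⊕ (v ⊕ z)))
               ↭-refl [ a ] (left M₃) (left M₄) (left blue) rest ⟩
        left M₃ ++ (left M₄ ++ left blue) ++ a ∷ rest
          ≡⟨ cong (λ z → left M₃ ++ z ++ a ∷ rest) (map-++ proj₁ M₄ blue) ⟨
        left M₃ ++ left (M₄ ++ blue) ++ a ∷ rest ∎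
    ; red-rel = proj₁ rels
    ; blue-rel = All.++⁺ (proj₂ rels) blue-rel
    ; distinct = Unique-resp-↭
        (↭-trans (right-++ M₃ M₄ (right blue))
          (↭-reflexive (cong (right M₃ ++_) (sym (map-++ proj₂ M₄ blue)))))
        (right-resp _ red↭ distinct)
    ; closed = closed″ }
    where
    open PermutationReasoning
    open CMSolver (++-commutativeMonoid {A = A})
    rels = All.++⁻ M₃ (All-resp-↭ red↭ red-rel)
    new : ∀ {x b} → x ∈ a ∷ left M₄ → Rel x b → b ∈ right (M₄ ++ blue)
    new x∈ xb = subst (_ ∈_) (sym (map-++ proj₂ M₄ blue)) (closed′ x∈ xb)
    old : ∀ {x b} → x ∈ left blue ++ rest → Rel x b → b ∈ right (M₄ ++ blue)
    old x∈ xb = subst (_ ∈_) (sym (map-++ proj₂ M₄ blue))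
      (∈-++⁺ʳ (right M₄) (closed x∈ xb))
    closed″ : ∀ {x b} → x ∈ left (M₄ ++ blue) ++ a ∷ rest → Rel x b →
              b ∈ right (M₄ ++ blue)
    closed″ {x} x∈ xb with ∈-++⁻ (left (M₄ ++ blue)) x∈
    ... | inj₂ (here refl) = new (here refl) xb
    ... | inj₂ (there x∈rest) = old (∈-++⁺ʳ (left blue) x∈rest) xb
    ... | inj₁ x∈left with ∈-++⁻ (left M₄) (subst (x ∈_) (map-++ proj₁ M₄ blue) x∈left)
    ... | inj₁ x∈M₄ = new (there x∈M₄) xb
    ... | inj₂ x∈blue = old (∈-++⁺ˡ x∈blue) xb

-- Sums and finite subsets

sum-mono-≤ : {f g : Fin n → ℕ} → (∀ i → f i ≤ g i) → sum f ≤ sum g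
sum-mono-≤ {zero}  f≤g = z≤n
sum-mono-≤ {suc n} f≤g = ℕ.+-mono-≤ (f≤g zero) (sum-mono-≤ (f≤g ∘ suc))

sum-zero : (f : Fin n → ℕ) → (∀ i → f i ≡ 0) → sum f ≡ 0
sum-zero {n} f f≡0 = trans (sum-cong-≗ f≡0) (sum-replicate-zero n)

term≤sum : (f : Fin n → ℕ) (i : Fin n) → f i ≤ sum f
term≤sum f zero    = ℕ.m≤m+n _ _
term≤sum f (suc i) = ℕ.≤-trans (term≤sum (f ∘ suc) i) (ℕ.m≤n+m _ _)

injective⇒≤length : {A : Set} {f : Fin m → A} {xs : List A} →
                    Injective _≡_ _≡_ f → (∀ i → f i ∈ xs) → m ≤ length xs
injective⇒≤length {xs = xs} f-inj f∈ = injective⇒≤ λ {i} {j} eq → f-inj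
  (trans (lookup-index (f∈ i))
    (trans (cong (lookup xs) eq) (sym (lookup-index (f∈ j)))))

enum : (W : Subset n) → Fin ∣ W ∣ → Fin n
enum (inside  ∷ W) zero    = zero
enum (inside  ∷ W) (suc i) = suc (enum W i)
enum (outside ∷ W) i       = suc (enum W i)

enum-∈ : (W : Subset n) (i : Fin ∣ W ∣) → enum W i ∈ˢ W
enum-∈ (inside  ∷ W) zero    = here
enum-∈ (inside  ∷ W) (suc i) = there (enum-∈ W i)
enum-∈ (outside ∷ W) i       = there (enum-∈ W i)

enum-injective : (W : Subset n) → Injective _≡_ _≡_ (enum W)
enum-injective (inside  ∷ W) {zero}  {zero}  _  = refl
enum-injective (inside  ∷ W) {suc i} {suc j} eq =
  cong suc (enum-injective W (Fin-suc-injective eq))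
enum-injective (outside ∷ W) eq = enum-injective W (Fin-suc-injective eq)

sum-enum : (W : Subset n) (f : Fin n → ℕ) → (∀ v → v ∉ˢ W → f v ≡ 0) →
           sum (f ∘ enum W) ≡ sum f
sum-enum []            f f≡0 = refl
sum-enum (inside  ∷ W) f f≡0 = cong (f zero +_)
  (sum-enum W (f ∘ suc) λ v v∉ → f≡0 (suc v) (v∉ ∘ drop-there))
sum-enum (outside ∷ W) f f≡0 rewrite f≡0 zero (λ ()) =
  sum-enum W (f ∘ suc) λ v v∉ → f≡0 (suc v) (v∉ ∘ drop-there)

𝟙 : {P : Set} → Dec P → ℕ
𝟙 (yes _) = 1
𝟙 (no  _) = 0

𝟙-⇔ : {P Q : Set} (P? : Dec P) (Q? : Dec Q) → (P → Q) → (Q → P) → 𝟙 P? ≡ 𝟙 Q?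
𝟙-⇔ (yes _) (yes _) _ _ = refl
𝟙-⇔ (no _)  (no _)  _ _ = refl
𝟙-⇔ (yes p) (no ¬q) f _ = contradiction (f p) ¬q
𝟙-⇔ (no ¬p) (yes q) _ g = contradiction (g q) ¬p

∣∣≡sum : (p : Subset n) → ∣ p ∣ ≡ sum λ v → 𝟙 (v ∈ˢ? p)
∣∣≡sum [] = refl
∣∣≡sum (s ∷ p) = trans (head s) (cong (𝟙 (zero ∈ˢ? (s ∷ p)) +_)
  (trans (∣∣≡sum p) (sum-cong-≗ λ v →
    𝟙-⇔ (v ∈ˢ? p) (suc v ∈ˢ? (s ∷ p)) there drop-there)))
  where
  head : ∀ s → ∣ s ∷ p ∣ ≡ 𝟙 (zero ∈ˢ? (s ∷ p)) + ∣ p ∣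
  head inside  = refl
  head outside = refl

module _ (v : Fin n) where

  through : List (Subset n) → List (Subset n)
  through = filter (v ∈ˢ?_)

  length-through-∷ : ∀ c cs →
    length (through (c ∷ cs)) ≡ 𝟙 (v ∈ˢ? c) + length (through cs)
  length-through-∷ c cs with v ∈ˢ? c
  ... | yes _ = refl
  ... | no  _ = refl

-- Incidences of vertices and sets are counted in both orders; `r = 2` is the handshake lemma.
double-count : (cs : List (Subset n)) → All (λ c → ∣ c ∣ ≡ r) cs →
               sum (λ v → length (through v cs)) ≡ r * length cs
double-count {n} {r} []       []           = trans (sum-replicate-zero n) (sym (ℕ.*-zeroʳ r))
double-count {n} {r} (c ∷ cs) (c≡r ∷ cs≡r) = begin
  sum (λ v → length (through v (c ∷ cs)))
    ≡⟨ sum-cong-≗ (λ v → length-through-∷ v c cs) ⟩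
  sum (λ v → 𝟙 (v ∈ˢ? c) + length (through v cs))
    ≡⟨ ∑-distrib-+ (λ v → 𝟙 (v ∈ˢ? c)) (λ v → length (through v cs)) ⟩
  sum (λ v → 𝟙 (v ∈ˢ? c)) + sum (λ v → length (through v cs))
    ≡⟨ cong₂ _+_ (trans (sym (∣∣≡sum c)) c≡r) (double-count cs cs≡r) ⟩
  r + r * length cs
    ≡⟨ ℕ.*-suc r (length cs) ⟨
  r * suc (length cs) ∎
  where open ≡-Reasoning

∣p∣≡suc∣p-x∣ : {p : Subset n} {x : Fin n} → x ∈ˢ p → ∣ p ∣ ≡ suc ∣ p - x ∣
∣p∣≡suc∣p-x∣ {p = _ ∷ p} here = cong (suc ∘ ∣_∣) (sym (p─⊥≡p p))
∣p∣≡suc∣p-x∣ {p = inside  ∷ p} (there x∈p) = cong suc (∣p∣≡suc∣p-x∣ x∈p)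
∣p∣≡suc∣p-x∣ {p = outside ∷ p} (there x∈p) = ∣p∣≡suc∣p-x∣ x∈p

remove-injective : {p q : Subset n} {x : Fin n} → x ∈ˢ p → x ∈ˢ q →
                   p - x ≡ q - x → p ≡ q
remove-injective {n} x∈p x∈q eq =
  ⊆-antisym (half x∈q eq) (half x∈p (sym eq))
  where
  half : {p q : Subset n} {x : Fin n} → x ∈ˢ q → p - x ≡ q - x → p ⊆ˢ q
  half {p} {q} {x} x∈q eq {y} y∈p with y ≟ᶠ x
  ... | yes refl = x∈q
  ... | no  y≢x  = p─q⊆p q ⁅ x ⁆ (subst (y ∈ˢ_) eq (x∈p∧x≢y⇒x∈p-y y∈p y≢x))

-- Removing `v` is injective only on sets that contain `v`, so membership has to be carried through
-- the list.
map-remove-unique : (v : Fin n) (cs : List (Subset n)) → All (v ∈ˢ_) cs → Unique cs →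
                    Unique (map (_- v) cs)
map-remove-unique v [] [] [] = []
map-remove-unique v (c ∷ cs) (v∈c ∷ v∈cs) (c∉ ∷ u) =
  fresh cs v∈cs c∉ ∷ map-remove-unique v cs v∈cs u
  where
  fresh : ∀ ds → All (v ∈ˢ_) ds → All (c ≢_) ds → All (c - v ≢_) (map (_- v) ds)
  fresh [] [] [] = []
  fresh (d ∷ ds) (v∈d ∷ v∈ds) (c≢d ∷ c≢) =
    (c≢d ∘ remove-injective v∈c v∈d) ∷ fresh ds v∈ds c≢

⊆∧∣∣≥⇒≡ : {p q : Subset n} → p ⊆ˢ q → ∣ q ∣ ≤ ∣ p ∣ → p ≡ q
⊆∧∣∣≥⇒≡ {p = p} {q} p⊆q q≤p = ⊆-antisym p⊆q λ {x} x∈q → ∈p x x∈q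
  where
  ∈p : ∀ x → x ∈ˢ q → x ∈ˢ p
  ∈p x x∈q with x ∈ˢ? p
  ... | yes x∈p = x∈p
  ... | no  x∉p = ⊥-elim (ℕ.<⇒≱ (p⊂q⇒∣p∣<∣q∣ (p⊆q , x , x∈q , x∉p)) q≤p)

∈-pairˡ : (u v : Fin n) → u ∈ˢ pair u v
∈-pairˡ u v = x∈p∪q⁺ (inj₁ (x∈⁅x⁆ u))

∈-pairʳ : (u v : Fin n) → v ∈ˢ pair u v
∈-pairʳ u v = x∈p∪q⁺ (inj₂ (x∈⁅x⁆ v))

∈-pair⁻ : {u v x : Fin n} → x ∈ˢ pair u v → x ≡ u ⊎ x ≡ v
∈-pair⁻ {u = u} {v} x∈ with x∈p∪q⁻ ⁅ u ⁆ ⁅ v ⁆ x∈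
... | inj₁ x∈u = inj₁ (x∈⁅y⁆⇒x≡y u x∈u)
... | inj₂ x∈v = inj₂ (x∈⁅y⁆⇒x≡y v x∈v)

pair-comm : (u v : Fin n) → pair u v ≡ pair v u
pair-comm u v = ∪-comm ⁅ u ⁆ ⁅ v ⁆

pair-⊆ : {u v : Fin n} {p : Subset n} → u ∈ˢ p → v ∈ˢ p → pair u v ⊆ˢ p
pair-⊆ u∈p v∈p x∈ with ∈-pair⁻ x∈
... | inj₁ refl = u∈p
... | inj₂ refl = v∈p

pair-injective : {u v u′ v′ : Fin n} → pair u v ≡ pair u′ v′ →
                 (u ≡ u′ × v ≡ v′) ⊎ (u ≡ v′ × v ≡ u′)
pair-injective {u = u} {v} {u′} {v′} eq
  with ∈-pair⁻ (subst (u ∈ˢ_) eq (∈-pairˡ u v))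
     | ∈-pair⁻ (subst (v ∈ˢ_) eq (∈-pairʳ u v))
... | inj₁ u≡u′ | inj₂ v≡v′ = inj₁ (u≡u′ , v≡v′)
... | inj₂ u≡v′ | inj₁ v≡u′ = inj₂ (u≡v′ , v≡u′)
... | inj₁ refl | inj₁ refl with ∈-pair⁻ (subst (v′ ∈ˢ_) (sym eq) (∈-pairʳ u′ v′))
...   | inj₁ v′≡u = inj₁ (refl , sym v′≡u)
...   | inj₂ v′≡u = inj₁ (refl , sym v′≡u)
pair-injective {u = u} {v} {u′} {v′} eq
    | inj₂ refl | inj₂ refl with ∈-pair⁻ (subst (u′ ∈ˢ_) (sym eq) (∈-pairˡ u′ v′))
...   | inj₁ u′≡u = inj₂ (refl , sym u′≡u)
...   | inj₂ u′≡u = inj₂ (refl , sym u′≡u)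

pair-cong : {u v u′ v′ : Fin m} (φ : Fin m → Fin n) → pair u v ≡ pair u′ v′ →
            pair (φ u) (φ v) ≡ pair (φ u′) (φ v′)
pair-cong φ eq with pair-injective eq
... | inj₁ (refl , refl) = refl
... | inj₂ (refl , refl) = pair-comm _ _

pair-cancel : {u v u′ v′ : Fin m} {φ : Fin m → Fin n} → Injective _≡_ _≡_ φ →
              pair (φ u) (φ v) ≡ pair (φ u′) (φ v′) → pair u v ≡ pair u′ v′
pair-cancel φ-inj eq with pair-injective eq
... | inj₁ (eq₁ , eq₂) = cong₂ pair (φ-inj eq₁) (φ-inj eq₂)
... | inj₂ (eq₁ , eq₂) = trans (cong₂ pair (φ-inj eq₁) (φ-inj eq₂)) (pair-comm _ _)

pair-injectiveʳ : (u : Fin n) → Injective _≡_ _≡_ (pair u)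
pair-injectiveʳ u eq with pair-injective eq
... | inj₁ (_ , v≡v′)    = v≡v′
... | inj₂ (refl , refl) = refl

∣pair∣≡2 : {u v : Fin n} → u ≢ v → ∣ pair u v ∣ ≡ 2
∣pair∣≡2 {u = zero}  {zero}  u≢v = contradiction refl u≢v
∣pair∣≡2 {u = zero}  {suc v} u≢v =
  cong suc (trans (cong ∣_∣ (∪-identityˡ ⁅ v ⁆)) (∣⁅x⁆∣≡1 v))
∣pair∣≡2 {u = suc u} {zero}  u≢v =
  cong suc (trans (cong ∣_∣ (∪-identityʳ ⁅ u ⁆)) (∣⁅x⁆∣≡1 u))
∣pair∣≡2 {u = suc u} {suc v} u≢v = ∣pair∣≡2 (u≢v ∘ cong suc)

two-elements : (p : Subset n) → 2 ≤ ∣ p ∣ → ∃₂ λ u v → u ≢ v × u ∈ˢ p × v ∈ˢ p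
two-elements p 2≤p with ∣ p ∣ | enum p | enum-∈ p | enum-injective p
two-elements p (s≤s (s≤s z≤n)) | suc (suc _) | e | e∈ | e-inj =
  e zero , e (suc zero) , (λ eq → contradiction (e-inj eq) λ ()) , e∈ zero , e∈ (suc zero)

∣p∣≡2⇒pair : (p : Subset n) → ∣ p ∣ ≡ 2 → ∃₂ λ u v → u ≢ v × p ≡ pair u v
∣p∣≡2⇒pair p p≡2 with two-elements p (ℕ.≤-reflexive (sym p≡2))
... | u , v , u≢v , u∈p , v∈p = u , v , u≢v ,
  sym (⊆∧∣∣≥⇒≡ (pair-⊆ u∈p v∈p) (ℕ.≤-reflexive (trans p≡2 (sym (∣pair∣≡2 u≢v)))))

-- Binomial coefficients

nC0≡1 : ∀ n → n C 0 ≡ 1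
nC0≡1 n = trans (nCk≡nC[n∸k] {0} {n} z≤n) (nCn≡1 n)

-- The absorption identity, by Pascal's rule and induction on `n`, used at both `r` and `r + 1`.
[1+r]*[1+n]C[1+r]≡[1+n]*nCr : ∀ n r → suc r * (suc n C suc r) ≡ suc n * (n C r)
[1+r]*[1+n]C[1+r]≡[1+n]*nCr zero zero = refl
[1+r]*[1+n]C[1+r]≡[1+n]*nCr zero (suc r)
  rewrite k>n⇒nCk≡0 {1} {2 + r} (s≤s (s≤s z≤n)) | k>n⇒nCk≡0 {0} {1 + r} (s≤s z≤n) =
  ℕ.*-zeroʳ (2 + r)
[1+r]*[1+n]C[1+r]≡[1+n]*nCr (suc n) zero
  rewrite nC1≡n (2 + n) | nC0≡1 (suc n) =
  trans (ℕ.*-identityˡ _) (sym (ℕ.*-identityʳ _))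
[1+r]*[1+n]C[1+r]≡[1+n]*nCr (suc n) (suc r) = begin
  (2 + r) * ((2 + n) C (2 + r))
    ≡⟨ cong ((2 + r) *_) (nCk+nC[k+1]≡[n+1]C[k+1] (suc n) (suc r)) ⟨
  (2 + r) * (c + suc n C (2 + r))
    ≡⟨ distrib r c (suc n C (2 + r)) ⟩
  c + (suc r * c + (2 + r) * (suc n C (2 + r)))
    ≡⟨ cong (c +_) (cong₂ _+_ ([1+r]*[1+n]C[1+r]≡[1+n]*nCr n r)
                               ([1+r]*[1+n]C[1+r]≡[1+n]*nCr n (suc r))) ⟩
  c + (suc n * (n C r) + suc n * (n C suc r))
    ≡⟨ cong (c +_) (ℕ.*-distribˡ-+ (suc n) (n C r) (n C suc r)) ⟨
  c + suc n * (n C r + n C suc r)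
    ≡⟨ cong (λ z → c + suc n * z) (nCk+nC[k+1]≡[n+1]C[k+1] n r) ⟩
  (2 + n) * c ∎
  where
  open ≡-Reasoning
  c = suc n C suc r
  distrib : ∀ r x y → (2 + r) * (x + y) ≡ x + ((1 + r) * x + (2 + r) * y)
  distrib = solve-∀

C-mono-suc : ∀ n r → n C r ≤ suc n C r
C-mono-suc n zero    = ℕ.≤-reflexive (trans (nC0≡1 n) (sym (nC0≡1 (suc n))))
C-mono-suc n (suc r) =
  ℕ.≤-trans (ℕ.m≤n+m _ _) (ℕ.≤-reflexive (nCk+nC[k+1]≡[n+1]C[k+1] n r))

C-monoˡ-≤ : ∀ {m n} r → m ≤ n → m C r ≤ n C r
C-monoˡ-≤ {m} r m≤n = subst (λ n → m C r ≤ n C r) (ℕ.m∸n+n≡m m≤n) (go (_ ∸ m))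
  where
  go : ∀ d → m C r ≤ (d + m) C r
  go zero    = ℕ.≤-refl
  go (suc d) = ℕ.≤-trans (go d) (C-mono-suc (d + m) r)

2*[2+t]Ct : ∀ t → 2 * ((2 + t) C t) ≡ (2 + t) * (1 + t)
2*[2+t]Ct t = begin
  2 * ((2 + t) C t)          ≡⟨ cong (2 *_) (nCk≡nC[n∸k] (ℕ.m≤n+m t 2)) ⟩
  2 * ((2 + t) C (2 + t ∸ t)) ≡⟨ cong (λ z → 2 * ((2 + t) C z)) (ℕ.m+n∸n≡m 2 t) ⟩
  2 * ((2 + t) C 2)          ≡⟨ [1+r]*[1+n]C[1+r]≡[1+n]*nCr (1 + t) 1 ⟩
  (2 + t) * ((1 + t) C 1)    ≡⟨ cong ((2 + t) *_) (nC1≡n (1 + t)) ⟩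
  (2 + t) * (1 + t)          ∎
  where open ≡-Reasoning

private
  -- Absorption pulls out the factor `1 + a`. After multiplication by `1 + t`, the two comparisons
  -- of the clique weight with 1 reduce to comparing `a C t` with `(2 + t) C t` and `(1 + t) C t`,
  -- which is monotonicity in the upper argument.
  scale : ∀ a t → (1 + t) * (2 * ((1 + a) C (1 + t))) ≡ (1 + a) * (2 * (a C t))
  scale a t = begin
    (1 + t) * (2 * ((1 + a) C (1 + t))) ≡⟨ swap (1 + t) ((1 + a) C (1 + t)) ⟩
    2 * ((1 + t) * ((1 + a) C (1 + t))) ≡⟨ cong (2 *_) ([1+r]*[1+n]C[1+r]≡[1+n]*nCr a t) ⟩
    2 * ((1 + a) * (a C t))             ≡⟨ swap (1 + a) (a C t) ⟨
    (1 + a) * (2 * (a C t))             ∎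
    where
    open ≡-Reasoning
    swap : ∀ x y → x * (2 * y) ≡ 2 * (x * y)
    swap = solve-∀

  rotate : ∀ x y z → x * (y * z) ≡ z * (y * x)
  rotate = solve-∀

-- In the next two lemmas k = 2 + a and r = 2 + t.
r[k-1]≤2[k-1]C[r-1] : ∀ a t → 2 + t ≤ a →
                      (2 + t) * (1 + a) ≤ 2 * ((1 + a) C (1 + t))
r[k-1]≤2[k-1]C[r-1] a t t≤a = ℕ.*-cancelˡ-≤ (1 + t) (begin
  (1 + t) * ((2 + t) * (1 + a))       ≡⟨ rotate (1 + t) (2 + t) (1 + a) ⟩
  (1 + a) * ((2 + t) * (1 + t))       ≡⟨ cong ((1 + a) *_) (2*[2+t]Ct t) ⟨
  (1 + a) * (2 * ((2 + t) C t))       ≤⟨ ℕ.*-monoʳ-≤ (1 + a) (ℕ.*-monoʳ-≤ 2 (C-monoˡ-≤ t t≤a)) ⟩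
  (1 + a) * (2 * (a C t))             ≡⟨ scale a t ⟨
  (1 + t) * (2 * ((1 + a) C (1 + t))) ∎)
  where open ℕ.≤-Reasoning

2[k-1]C[r-1]≤r[k-1] : ∀ a t → a ≤ 1 + t →
                      2 * ((1 + a) C (1 + t)) ≤ (2 + t) * (1 + a)
2[k-1]C[r-1]≤r[k-1] a t a≤t = ℕ.*-cancelˡ-≤ (1 + t) (begin
  (1 + t) * (2 * ((1 + a) C (1 + t))) ≡⟨ scale a t ⟩
  (1 + a) * (2 * (a C t))             ≤⟨ ℕ.*-monoʳ-≤ (1 + a) (ℕ.*-monoʳ-≤ 2 (C-monoˡ-≤ t a≤t)) ⟩
  (1 + a) * (2 * ((1 + t) C t))       ≡⟨ cong (λ z → (1 + a) * (2 * z)) [1+t]Ct ⟩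
  (1 + a) * (2 * (1 + t))             ≤⟨ ℕ.*-monoʳ-≤ (1 + a) (ℕ.*-monoˡ-≤ (1 + t) (ℕ.m≤m+n 2 t)) ⟩
  (1 + a) * ((2 + t) * (1 + t))       ≡⟨ rotate (1 + t) (2 + t) (1 + a) ⟨
  (1 + t) * ((2 + t) * (1 + a))       ∎)
  where
  open ℕ.≤-Reasoning
  [1+t]Ct : (1 + t) C t ≡ 1 + t
  [1+t]Ct = trans (nCk≡nC[n∸k] (ℕ.n≤1+n t))
    (trans (cong ((1 + t) C_) (ℕ.m+n∸n≡m 1 t)) (nC1≡n (1 + t)))

combinations : (n r : ℕ) → List (Subset n)
combinations zero    zero    = [ [] ]
combinations zero    (suc r) = []
combinations (suc n) zero    = map (outside ∷_) (combinations n zero)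
combinations (suc n) (suc r) =
  map (inside ∷_) (combinations n r) ++ map (outside ∷_) (combinations n (suc r))

length-combinations : ∀ n r → length (combinations n r) ≡ n C r
length-combinations zero    zero    = refl
length-combinations zero    (suc r) = sym (k>n⇒nCk≡0 {0} {suc r} (s≤s z≤n))
length-combinations (suc n) zero    =
  trans (length-map _ (combinations n 0))
    (trans (length-combinations n 0) (trans (nC0≡1 n) (sym (nC0≡1 (suc n)))))
length-combinations (suc n) (suc r) =
  trans (length-++ (map (inside ∷_) (combinations n r)))
    (trans (cong₂ _+_ (trans (length-map _ (combinations n r)) (length-combinations n r))
                      (trans (length-map _ (combinations n (suc r))) (length-combinations n (suc r))))
           (nCk+nC[k+1]≡[n+1]C[k+1] n r))

combinations-unique : ∀ n r → Unique (combinations n r)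
combinations-unique zero    zero    = [] ∷ []
combinations-unique zero    (suc r) = []
combinations-unique (suc n) zero    = Unique.map⁺ ∷-injectiveʳ (combinations-unique n zero)
combinations-unique (suc n) (suc r) = Unique.++⁺
  (Unique.map⁺ ∷-injectiveʳ (combinations-unique n r))
  (Unique.map⁺ ∷-injectiveʳ (combinations-unique n (suc r)))
  λ (∈in , ∈out) → disjoint (∈-map⁻ (inside ∷_) ∈in) (∈-map⁻ (outside ∷_) ∈out)
  where
  disjoint : ∀ {p : Subset (suc n)} {xs ys} → (∃ λ q → q ∈ xs × p ≡ inside ∷ q) →
             ¬ (∃ λ q → q ∈ ys × p ≡ outside ∷ q)
  disjoint (_ , _ , refl) (_ , _ , ())

combinations-uniform : ∀ n r → All (λ p → ∣ p ∣ ≡ r) (combinations n r)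
combinations-uniform zero    zero    = refl ∷ []
combinations-uniform zero    (suc r) = []
combinations-uniform (suc n) zero    = All.map⁺ (combinations-uniform n zero)
combinations-uniform (suc n) (suc r) = All.++⁺
  (All.map⁺ (All.map (cong suc) (combinations-uniform n r)))
  (All.map⁺ (combinations-uniform n (suc r)))

∈-combinations : ∀ {n} (p : Subset n) → p ∈ combinations n ∣ p ∣
∈-combinations [] = here refl
∈-combinations (inside  ∷ p) = ∈-++⁺ˡ (∈-map⁺ (inside ∷_) (∈-combinations p))
∈-combinations (outside ∷ p) with ∣ p ∣ | ∈-combinations p
... | zero  | p∈ = ∈-map⁺ (outside ∷_) p∈
... | suc r | p∈ = ∈-++⁺ʳ (map (inside ∷_) (combinations _ r)) (∈-map⁺ (outside ∷_) p∈)

-- Graphs as decidable relations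

select : {P : Fin n → Set} → (∀ i → Dec (P i)) → Subset n
select P? = tabulate (does ∘ P?)

module _ {P : Fin n → Set} (P? : ∀ i → Dec (P i)) where

  ∈-select⁺ : ∀ {i} → P i → i ∈ˢ select P?
  ∈-select⁺ {i} Pi =
    lookup⇒[]= i _ (trans (lookup∘tabulate (does ∘ P?) i) (dec-true (P? i) Pi))

  ∈-select⁻ : ∀ {i} → i ∈ˢ select P? → P i
  ∈-select⁻ {i} i∈ with P? i | trans (sym (lookup∘tabulate (does ∘ P?) i)) ([]=⇒lookup i∈)
  ... | yes Pi | _ = Pi

-- Links, deletions and restrictions are immediate for relations, whereas edge lists would have to
-- be rebuilt together with their uniqueness. `degree-sum` stands for twice the number of edges, so
-- counting needs no edge list either.
record Relational (n : ℕ) : Set₁ where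
  field
    _~_     : Fin n → Fin n → Set
    _~?_    : ∀ u v → Dec (u ~ v)
    ~-sym   : ∀ {u v} → u ~ v → v ~ u
    ~-irrefl : ∀ {v} → ¬ (v ~ v)

  nbrs : Fin n → Subset n
  nbrs v = select (v ~?_)

  degree-sum : ℕ
  degree-sum = sum (λ v → ∣ nbrs v ∣)

  Clique : Subset n → Set
  Clique c = ∀ {u v} → u ∈ˢ c → v ∈ˢ c → u ≢ v → u ~ v

  Embeds : Graph p → Set
  Embeds {p} S = Σ (Fin p → Fin n) λ φ →
    Injective _≡_ _≡_ φ × (∀ u v → Adj S u v → φ u ~ φ v)

open Relational using (degree-sum; nbrs; Clique; Embeds)

Adj-sym : (G : Graph n) {u v : Fin n} → Adj G u v → Adj G v u
Adj-sym G {u} {v} = subst (_∈ edges G) (pair-comm u v)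

Adj-irrefl : (G : Graph n) {v : Fin n} → ¬ Adj G v v
Adj-irrefl G {v} vv
  with trans (sym (∣⁅x⁆∣≡1 v))
         (trans (cong ∣_∣ (sym (∪-idem ⁅ v ⁆))) (All.lookup (uniform G) vv))
... | ()

relational : Graph n → Relational n
relational G = record
  { _~_ = Adj G ; _~?_ = adj? G ; ~-sym = Adj-sym G ; ~-irrefl = Adj-irrefl G }

pullback : (Fin m → Fin n) → Relational n → Relational m
pullback f R = record
  { _~_ = λ u v → f u ~ f v ; _~?_ = λ u v → f u ~? f v
  ; ~-sym = ~-sym ; ~-irrefl = ~-irrefl }
  where open Relational R

module _ (R : Relational n) where
  open Relational R hiding (Embeds; degree-sum; nbrs; Clique)

  abstract
    private
      IsEdge : Subset n → Set
      IsEdge e = ∃₂ λ u v → e ≡ pair u v × u ~ v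

      isEdge? : ∀ e → Dec (IsEdge e)
      isEdge? e = any? λ u → any? λ v → (e ≟ˢ pair u v) ×-dec (u ~? v)

    graph : Graph n
    graph = mkHypergraph (filter isEdge? (combinations n 2))
      (Unique.filter⁺ isEdge? (combinations-unique n 2))
      (All.filter⁺ isEdge? (combinations-uniform n 2))

    Adj-graph⁺ : ∀ {u v} → u ~ v → Adj graph u v
    Adj-graph⁺ {u} {v} u~v = ∈-filter⁺ isEdge?
      (subst (λ s → pair u v ∈ combinations n s)
        (∣pair∣≡2 {u = u} {v} λ { refl → ~-irrefl u~v }) (∈-combinations (pair u v)))
      (u , v , refl , u~v)

    Adj-graph⁻ : ∀ {u v} → Adj graph u v → u ~ v
    Adj-graph⁻ {u} {v} uv
      with ∈-filter⁻ isEdge? {xs = combinations n 2} uv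
    ... | _ , u′ , v′ , eq , u′~v′ with pair-injective eq
    ...   | inj₁ (refl , refl) = u′~v′
    ...   | inj₂ (refl , refl) = ~-sym u′~v′

-- The neighbours `w` of `v` inject into the edges of `G` at `v` by taking `w` to `pair v w`; the
-- handshake lemma sums this over `v`.
degree-sum-≤ : (G : Graph n) (R : Relational n) →
  (∀ {u v} → Relational._~_ R u v → Adj G u v) → degree-sum R ≤ 2 * size G
degree-sum-≤ G R R⊆G =
  ℕ.≤-trans (sum-mono-≤ degree-≤) (ℕ.≤-reflexive (double-count (edges G) (uniform G)))
  where
  open Relational R using (_~?_)
  degree-≤ : ∀ v → ∣ nbrs R v ∣ ≤ length (through v (edges G))
  degree-≤ v = injective⇒≤length {f = pair v ∘ enum (nbrs R v)}
    (enum-injective (nbrs R v) ∘ pair-injectiveʳ v)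
    λ i → ∈-filter⁺ (v ∈ˢ?_) (R⊆G (∈-select⁻ (v ~?_) (enum-∈ (nbrs R v) i)))
                    (∈-pairˡ v _)

Star-first : {A : Set} {_⟶_ : A → A → Set} {x y : A} → x ≢ y → Star _⟶_ x y →
             ∃ λ z → x ⟶ z
Star-first x≢x ε       = contradiction refl x≢x
Star-first _   (s ◅ _) = _ , s

other : (v : Fin (2 + n)) → ∃ λ w → v ≢ w
other zero    = suc zero , λ ()
other (suc v) = zero , λ ()

connected-neighbour : (G : Graph (2 + n)) → Connected G → ∀ v → ∃ λ w → Adj G v w
connected-neighbour G conn v with other v
... | w , v≢w = Star-first v≢w (conn v w)

erdős-sós-size :
  ErdősSós → ∀ ℓ → 1 ≤ ℓ → (S : Graph (suc ℓ)) → IsTree S →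
  (G : Graph n) → ¬ ContainsSubgraph S G → 2 * size G ≤ (ℓ ∸ 1) * n
-- `ErdősSós` covers only `1 ≤ n`, but the vertex set can be empty here: it will be the
-- neighbourhood of a possibly isolated vertex.
erdős-sós-size {zero} _ _ _ _ _ (mkHypergraph [] _ _) _ = z≤n
erdős-sós-size {zero} _ _ _ _ _ (mkHypergraph ([] ∷ _) _ (() ∷ _)) _
erdős-sós-size {suc n} es ℓ 1≤ℓ S tree G ¬S =
  ℕ.≤-trans (ℕ.*-monoʳ-≤ 2 (Turán.ex-max (suc n) S G ¬S))
            (es ℓ 1≤ℓ S tree (suc n) (s≤s z≤n))

-- In a link only the neighbourhood `W` may be charged, as a bound in terms of `n` would be too
-- weak. Vertices outside `W` are isolated, so pulling back along `enum W` loses no degrees.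
erdős-sós-degree-sum :
  ErdősSós → ∀ ℓ → 1 ≤ ℓ → (S : Graph (suc ℓ)) → IsTree S →
  (R : Relational n) → ¬ Embeds R S →
  (W : Subset n) → (∀ {u v} → Relational._~_ R u v → u ∈ˢ W) →
  degree-sum R ≤ (ℓ ∸ 1) * ∣ W ∣
erdős-sós-degree-sum {n} es ℓ 1≤ℓ S tree R ¬S W supp = begin
  degree-sum R             ≡⟨ sum-enum W (λ v → ∣ nbrs R v ∣) isolated ⟨
  sum (λ i → ∣ nbrs R (enum W i) ∣) ≡⟨ sum-cong-≗ restrict-degree ⟨
  degree-sum R′            ≤⟨ degree-sum-≤ G R′ (Adj-graph⁺ R′) ⟩
  2 * size G               ≤⟨ erdős-sós-size es ℓ 1≤ℓ S tree G ¬SG ⟩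
  (ℓ ∸ 1) * ∣ W ∣          ∎
  where
  open ℕ.≤-Reasoning
  open Relational R using (_~_; _~?_; ~-sym)
  R′ = pullback (enum W) R
  G = graph R′
  ¬SG : ¬ ContainsSubgraph S G
  ¬SG (φ , φ-inj , hom) = ¬S (enum W ∘ φ , φ-inj ∘ enum-injective W ,
    λ u v uv → Adj-graph⁻ R′ (hom u v uv))
  isolated : ∀ v → v ∉ˢ W → ∣ nbrs R v ∣ ≡ 0
  isolated v v∉W = trans (∣∣≡sum (nbrs R v)) (sum-zero _ λ u → none u)
    where
    none : ∀ u → 𝟙 (u ∈ˢ? nbrs R v) ≡ 0
    none u with u ∈ˢ? nbrs R v
    ... | yes u∈ = contradiction (supp (∈-select⁻ (v ~?_) u∈)) v∉W
    ... | no  _  = refl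
  restrict-degree : ∀ i → ∣ nbrs R′ i ∣ ≡ ∣ nbrs R (enum W i) ∣
  restrict-degree i = begin-equality
    ∣ nbrs R′ i ∣                              ≡⟨ ∣∣≡sum (nbrs R′ i) ⟩
    sum (λ j → 𝟙 (j ∈ˢ? nbrs R′ i))            ≡⟨ sum-cong-≗ (λ j → 𝟙-⇔ (j ∈ˢ? nbrs R′ i) (enum W j ∈ˢ? nbrs R v)
      (∈-select⁺ (v ~?_) ∘ ∈-select⁻ (λ j → v ~? enum W j))
      (∈-select⁺ (λ j → v ~? enum W j) ∘ ∈-select⁻ (v ~?_))) ⟩
    sum (λ j → 𝟙 (enum W j ∈ˢ? nbrs R v))      ≡⟨ sum-enum W (λ u → 𝟙 (u ∈ˢ? nbrs R v)) outside-W ⟩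
    sum (λ u → 𝟙 (u ∈ˢ? nbrs R v))             ≡⟨ ∣∣≡sum (nbrs R v) ⟨
    ∣ nbrs R v ∣                               ∎
    where
    v = enum W i
    outside-W : ∀ u → u ∉ˢ W → 𝟙 (u ∈ˢ? nbrs R v) ≡ 0
    outside-W u u∉W with u ∈ˢ? nbrs R v
    ... | yes u∈ = contradiction (supp (~-sym (∈-select⁻ (v ~?_) u∈))) u∉W
    ... | no  _  = refl

-- Trees

module _ (S : Graph (suc p)) (x : Fin (suc p)) where

  delete : Graph p
  delete = graph (pullback (punchIn x) (relational S))

  delete⁺ : ∀ {i j} → Adj S (punchIn x i) (punchIn x j) → Adj delete i j
  delete⁺ = Adj-graph⁺ (pullback (punchIn x) (relational S))

  delete⁻ : ∀ {i j} → Adj delete i j → Adj S (punchIn x i) (punchIn x j)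
  delete⁻ = Adj-graph⁻ (pullback (punchIn x) (relational S))

  delete-acyclic : Acyclic S → Acyclic delete
  delete-acyclic acyclic m c = acyclic m record
    { vertex = punchIn x ∘ vertex
    ; injective = injective ∘ punchIn-injective x _ _
    ; step = delete⁻ ∘ step
    ; close = delete⁻ close }
    where open Cycle c

  restrict : Fin p → Fin (suc p) → Fin p
  restrict y u with x ≟ᶠ u
  ... | yes _   = y
  ... | no  x≢u = punchOut x≢u

  -- A path through a leaf x with neighbour y becomes a path in S − x by
  -- replacing x with y, since the edge x y collapses.
  delete-connected : ∀ y → (∀ {z} → Adj S x z → z ≡ punchIn x y) →
                     Connected S → Connected delete
  delete-connected y leaf conn i j =
    subst₂ (Star (Adj delete)) (restrict-punchIn i) (restrict-punchIn j)
      (walk (conn (punchIn x i) (punchIn x j)))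
    where
    ρ = restrict y
    restrict-punchIn : ∀ i → ρ (punchIn x i) ≡ i
    restrict-punchIn i with x ≟ᶠ punchIn x i
    ... | yes x≡ = contradiction (sym x≡) (punchInᵢ≢i x i)
    ... | no  x≢ = trans (punchOut-cong′ x {p = x≢} refl) (punchOut-punchIn x)
    step : ∀ u v → Adj S u v → ρ u ≡ ρ v ⊎ Adj delete (ρ u) (ρ v)
    step u v uv with x ≟ᶠ u
    step u v uv | yes refl with leaf uv
    step u .(punchIn x y) uv | yes refl | refl = inj₁ (sym (restrict-punchIn y))
    step u v uv | no x≢u with x ≟ᶠ v
    step u v uv | no x≢u | no x≢v =
      inj₂ (delete⁺ (subst₂ (Adj S) (sym (punchIn-punchOut x≢u))
                                    (sym (punchIn-punchOut x≢v)) uv))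
    step u v uv | no x≢u | yes refl with leaf (Adj-sym S uv)
    step .(punchIn x y) v uv | no x≢u | yes refl | refl =
      inj₁ (trans (punchOut-cong′ x {p = x≢u} refl) (punchOut-punchIn x))
    walk : ∀ {u v} → Star (Adj S) u v → Star (Adj delete) (ρ u) (ρ v)
    walk ε = ε
    walk {u} {v} (_◅_ {j = w} uw rest) with step u w uw
    ... | inj₁ eq = subst (λ z → Star (Adj delete) z (ρ v)) (sym eq) (walk rest)
    ... | inj₂ ρuw = ρuw ◅ walk rest

module _ (S : Graph n) (walk : ℕ → Fin n)
         (walk-step : ∀ i → Adj S (walk i) (walk (suc i)))
         (walk-forward : ∀ i → walk (2 + i) ≢ walk i) where

  private
    ordered : ∀ m i → (∀ {d} → d < 2 + m → ∀ j → walk j ≢ walk (suc d + j)) →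
              ∀ (s t : Fin (3 + m)) → toℕ s < toℕ t → walk (toℕ s + i) ≢ walk (toℕ t + i)
    ordered m i minimal s t s<t eq′ = minimal (ℕ.≤-trans gap≤t (s≤s⁻¹ (toℕ<n t)))
      (toℕ s + i) (trans eq′ (cong walk (sym shifted)))
      where
      d = toℕ t ∸ suc (toℕ s)
      suc-d+s≡t : suc d + toℕ s ≡ toℕ t
      suc-d+s≡t = trans (sym (ℕ.+-suc d (toℕ s))) (ℕ.m∸n+n≡m s<t)
      gap≤t : suc d ≤ toℕ t
      gap≤t = subst (suc d ≤_) suc-d+s≡t (ℕ.m≤m+n (suc d) (toℕ s))
      shifted : suc d + (toℕ s + i) ≡ toℕ t + i
      shifted = trans (sym (ℕ.+-assoc (suc d) (toℕ s) i)) (cong (_+ i) suc-d+s≡t)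

    injective-stretch : ∀ m i → (∀ {d} → d < 2 + m → ∀ j → walk j ≢ walk (suc d + j)) →
                        Injective _≡_ _≡_ (λ (t : Fin (3 + m)) → walk (toℕ t + i))
    injective-stretch m i minimal {s} {t} eq with ℕ.<-cmp (toℕ s) (toℕ t)
    ... | tri< s<t _ _ = contradiction eq (ordered m i minimal s t s<t)
    ... | tri≈ _ s≡t _ = toℕ-injective s≡t
    ... | tri> _ _ t<s = contradiction (sym eq) (ordered m i minimal t s t<s)

  -- Strong induction on the length `suc d` of a return. Length 1 would be a loop and length 2 a
  -- step back; from length 3 on, the absence of shorter returns makes the stretch injective, hence
  -- a cycle.
  no-return : Acyclic S → ∀ d i → walk i ≢ walk (suc d + i)
  no-return acyclic = <-rec _ go
    where
    go : ∀ d → (∀ {d′} → d′ < d → ∀ i → walk i ≢ walk (suc d′ + i)) →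
         ∀ i → walk i ≢ walk (suc d + i)
    go zero _ i eq = Adj-irrefl S (subst (Adj S (walk i)) (sym eq) (walk-step i))
    go (suc zero) _ i eq = walk-forward i (sym eq)
    go (suc (suc m)) minimal i eq = acyclic m record
      { vertex = λ t → walk (toℕ t + i)
      ; injective = injective-stretch m i minimal
      ; step = λ t → subst (λ s → Adj S (walk (s + i)) (walk (suc (toℕ t + i))))
                       (sym (toℕ-inject₁ t)) (walk-step (toℕ t + i))
      ; close = subst₂ (Adj S) (cong (λ s → walk (s + i)) (sym (toℕ-fromℕ (2 + m))))
                  (sym eq) (walk-step (2 + m + i)) }

  walk⇒¬acyclic : ¬ Acyclic S
  walk⇒¬acyclic acyclic with pigeonhole (ℕ.n<1+n n) (walk ∘ toℕ)
  ... | i , j , i<j , eq = no-return acyclic (toℕ j ∸ suc (toℕ i)) (toℕ i)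
    (trans eq (cong walk (sym (trans (sym (ℕ.+-suc _ (toℕ i))) (ℕ.m∸n+n≡m i<j)))))

-- If no vertex is a leaf, a walk can be continued forever without turning
-- back; a closed stretch of minimal length in it is a cycle.
module _ (S : Graph n) {u v : Fin n} (uv : Adj S u v)
         (continue : ∀ {x y} → Adj S x y → ∃ λ z → Adj S x z × z ≢ y) where

  private
    -- The current vertex comes first and its predecessor second, so that `continue` leaves the
    -- current vertex without turning back.
    arc : ℕ → ∃₂ λ x y → Adj S x y
    arc zero    = u , v , uv
    arc (suc i) = _ , _ , Adj-sym S (proj₁ (proj₂ (continue (proj₂ (proj₂ (arc i))))))

  endless⇒¬acyclic : ¬ Acyclic S
  endless⇒¬acyclic = walk⇒¬acyclic S (proj₁ ∘ arc)
    (λ i → proj₁ (proj₂ (continue (proj₂ (proj₂ (arc i))))))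
    (λ i → proj₂ (proj₂ (continue (proj₂ (proj₂ (arc (suc i)))))))

Leaf : Graph p → Fin p → Fin p → Set
Leaf S x y = Adj S x y × (∀ z → Adj S x z → z ≡ y)

leaf? : (S : Graph p) → ∀ x y → Dec (Leaf S x y)
leaf? S x y = adj? S x y ×-dec all? λ z → adj? S x z →-dec (z ≟ᶠ y)

leafless⇒¬acyclic : (S : Graph n) (u v : Fin n) → Adj S u v →
                    ¬ (∃₂ (Leaf S)) → ¬ Acyclic S
leafless⇒¬acyclic S u v uv ¬leaf = endless⇒¬acyclic S uv continue
  where
  continue : ∀ {x y} → Adj S x y → ∃ λ z → Adj S x z × z ≢ y
  continue {x} {y} xy = decidable-stable (any? further?) λ ¬next →
    ¬leaf (x , y , xy , λ z xz → decidable-stable (z ≟ᶠ y)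
      λ z≢y → ¬next (z , xz , z≢y))
    where
    further? : ∀ z → Dec (Adj S x z × z ≢ y)
    further? z = adj? S x z ×-dec ¬? (z ≟ᶠ y)

leaf-exists : (S : Graph (2 + p)) → IsTree S → ∃₂ (Leaf S)
leaf-exists S (conn , acyclic) = decidable-stable (any? λ x → any? (leaf? S x))
  λ ¬leaf → leafless⇒¬acyclic S zero _ (proj₂ (connected-neighbour S conn zero)) ¬leaf acyclic

abstract
  prune : (S : Graph (2 + p)) → IsTree S → ∃ λ x → IsTree (delete S x)
  prune {p} S (conn , acyclic) = from-leaf (leaf-exists S (conn , acyclic))
    where
    from-leaf : ∃₂ (Leaf S) → ∃ λ x → IsTree (delete S x)
    from-leaf (x , y , xy , only-y) = x ,
      delete-connected S x (punchOut x≢y)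
        (λ xz → trans (only-y _ xz) (sym (punchIn-punchOut x≢y))) conn ,
      delete-acyclic S x acyclic
      where
      x≢y : x ≢ y
      x≢y refl = Adj-irrefl S xy

-- Counting cliques

unique-⊆⇒length≤ : {A : Set} {xs ys : List A} → Unique xs →
                   (∀ {x} → x ∈ xs → x ∈ ys) → length xs ≤ length ys
unique-⊆⇒length≤ u xs⊆ys = injective⇒≤length (lookup-injective u) (λ i → xs⊆ys (∈-lookup i))

x∉p-x : {q : Subset n} {x : Fin n} → x ∈ˢ q → x ∉ˢ q - x
x∉p-x {q = q} {x} x∈q x∈q-x =
  ℕ.<-irrefl refl (subst (_≤ ∣ q - x ∣) (∣p∣≡suc∣p-x∣ x∈q) (p⊆q⇒∣p∣≤∣q∣ q⊆q-x))
  where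
  q⊆q-x : q ⊆ˢ q - x
  q⊆q-x {y} y∈q with y ≟ᶠ x
  ... | yes refl = x∈q-x
  ... | no  y≢x  = x∈p∧x≢y⇒x∈p-y y∈q y≢x

record Cliques (R : Relational n) (r : ℕ) (cs : List (Subset n)) : Set where
  field
    cs-unique  : Unique cs
    cs-uniform : All (λ c → ∣ c ∣ ≡ r) cs
    cs-cliques : All (Clique R) cs

-- The graph induced on the neighbourhood of `v`, kept on all of `Fin n` with the other vertices
-- isolated.
link : Relational n → Fin n → Relational n
link R v = record
  { _~_      = λ x y → v ~ x × v ~ y × x ~ y
  ; _~?_     = λ x y → (v ~? x) ×-dec (v ~? y) ×-dec (x ~? y)
  ; ~-sym    = λ (vx , vy , xy) → vy , vx , ~-sym xy
  ; ~-irrefl = λ (_ , _ , xx) → ~-irrefl xx }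
  where open Relational R

module _ (R : Relational n) (v : Fin n) where
  open Relational R using (_~_; _~?_; ~-sym; ~-irrefl)

  -- Place `x` at `v`. Since `delete S x` is connected on at least two vertices, each of its
  -- vertices has a neighbour, so its image has an edge in the link and is therefore adjacent to
  -- `v`.
  cone : (S : Graph (3 + p)) (x : Fin (3 + p)) → Connected (delete S x) →
         Embeds (link R v) (delete S x) → Embeds R S
  cone {p} S x conn (ψ , ψ-inj , hom) = φ , φ-inj , φ-hom
    where
    v~ψ : ∀ i → v ~ ψ i
    v~ψ i = proj₁ (hom i _ (proj₂ (connected-neighbour (delete S x) conn i)))
    φ : Fin (3 + p) → Fin n
    φ u with x ≟ᶠ u
    ... | yes _   = v
    ... | no  x≢u = ψ (punchOut x≢u)
    φ-inj : Injective _≡_ _≡_ φ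
    φ-inj {u} {w} eq with x ≟ᶠ u | x ≟ᶠ w
    ... | yes refl | yes refl = refl
    ... | yes _    | no x≢w   = ⊥-elim (~-irrefl (subst (v ~_) (sym eq) (v~ψ (punchOut x≢w))))
    ... | no x≢u   | yes _    = ⊥-elim (~-irrefl (subst (v ~_) eq (v~ψ (punchOut x≢u))))
    ... | no x≢u   | no x≢w   = punchOut-injective x≢u x≢w (ψ-inj eq)
    φ-hom : ∀ u w → Adj S u w → φ u ~ φ w
    φ-hom u w uw with x ≟ᶠ u | x ≟ᶠ w
    ... | yes refl | yes refl = contradiction uw (Adj-irrefl S)
    ... | yes _    | no x≢w   = v~ψ (punchOut x≢w)
    ... | no x≢u   | yes _    = ~-sym (v~ψ (punchOut x≢u))
    ... | no x≢u   | no x≢w   = proj₂ (proj₂ (hom _ _ (delete⁺ S x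
      (subst₂ (Adj S) (sym (punchIn-punchOut x≢u)) (sym (punchIn-punchOut x≢w)) uw))))

  links : List (Subset n) → List (Subset n)
  links cs = map (_- v) (through v cs)

  remove-nbrs : ∀ {c} → Clique R c → v ∈ˢ c → ∀ {y} → y ∈ˢ c - v → v ~ y
  remove-nbrs {c} clique v∈c {y} y∈ = clique v∈c (p─q⊆p c ⁅ v ⁆ y∈)
    λ { refl → x∉p-x v∈c y∈ }

  module _ {r} {cs} (fam : Cliques R (suc r) cs) where
    open Cliques fam

    through⁻ : ∀ {c} → c ∈ through v cs → c ∈ cs × v ∈ˢ c
    through⁻ = ∈-filter⁻ (v ∈ˢ?_) {xs = cs}

    links-cliques : Cliques (link R v) r (links cs)
    links-cliques = record
      { cs-unique  = map-remove-unique v (through v cs) (All.all-filter (v ∈ˢ?_) cs)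
                       (Unique.filter⁺ (v ∈ˢ?_) cs-unique)
      ; cs-uniform = All.map⁺ (All.tabulate λ c∈ →
          ℕ.suc-injective (trans (sym (∣p∣≡suc∣p-x∣ (proj₂ (through⁻ c∈))))
                                 (All.lookup cs-uniform (proj₁ (through⁻ c∈)))))
      ; cs-cliques = All.map⁺ (All.tabulate λ {c} c∈ {x} {y} x∈ y∈ x≢y →
          let clique : Clique R c
              clique = All.lookup cs-cliques (proj₁ (through⁻ c∈))
              v∈c = proj₂ (through⁻ c∈)
          in remove-nbrs clique v∈c x∈ , remove-nbrs clique v∈c y∈ ,
             clique (p─q⊆p c ⁅ v ⁆ x∈) (p─q⊆p c ⁅ v ⁆ y∈) x≢y) }

    links-⊆ : All (_⊆ˢ nbrs R v) (links cs)
    links-⊆ = All.map⁺ (All.tabulate λ {c} c∈ {y} y∈ → ∈-select⁺ (v ~?_)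
      (remove-nbrs (All.lookup cs-cliques (proj₁ (through⁻ c∈))) (proj₂ (through⁻ c∈)) y∈))

singletons-bound : (W : Subset n) (cs : List (Subset n)) → Unique cs →
                   All (λ c → ∣ c ∣ ≡ 1) cs → All (_⊆ˢ W) cs → length cs ≤ ∣ W ∣
singletons-bound W cs u cs≡1 cs⊆W = begin
  length cs                          ≡⟨ ℕ.*-identityˡ (length cs) ⟨
  1 * length cs                      ≡⟨ double-count cs cs≡1 ⟨
  sum (λ v → length (through v cs))  ≤⟨ sum-mono-≤ at-most-one ⟩
  sum (λ v → 𝟙 (v ∈ˢ? W))            ≡⟨ ∣∣≡sum W ⟨
  ∣ W ∣                              ∎
  where
  open ℕ.≤-Reasoning
  at-most-one : ∀ v → length (through v cs) ≤ 𝟙 (v ∈ˢ? W)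
  at-most-one v with v ∈ˢ? W
  ... | yes _ = unique-⊆⇒length≤ {ys = [ ⁅ v ⁆ ]} (Unique.filter⁺ (v ∈ˢ?_) u) λ {c} c∈ →
    let c∈cs , v∈c = ∈-filter⁻ (v ∈ˢ?_) {xs = cs} c∈
    in here (sym (⊆∧∣∣≥⇒≡ (λ x∈ → subst (_∈ˢ c) (sym (x∈⁅y⁆⇒x≡y v x∈)) v∈c)
         (ℕ.≤-reflexive (trans (All.lookup cs≡1 c∈cs) (sym (∣⁅x⁆∣≡1 v))))))
  ... | no v∉W = unique-⊆⇒length≤ {ys = []} (Unique.filter⁺ (v ∈ˢ?_) u) λ {c} c∈ →
    let c∈cs , v∈c = ∈-filter⁻ (v ∈ˢ?_) {xs = cs} c∈
    in contradiction (All.lookup cs⊆W c∈cs v∈c) v∉W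

no-cliques : (R : Relational n) → degree-sum R ≤ 0 → ∀ {t cs} →
             Cliques R (2 + t) cs → length cs ≡ 0
no-cliques R deg≤0 {cs = []} _ = refl
no-cliques R deg≤0 {cs = c ∷ cs} record { cs-uniform = c≡ ∷ _ ; cs-cliques = clique ∷ _ }
  with two-elements c (ℕ.≤-trans (s≤s (s≤s z≤n)) (ℕ.≤-reflexive (sym c≡)))
... | u , v , u≢v , u∈c , v∈c = contradiction
  (ℕ.≤-trans nbr (ℕ.≤-trans (term≤sum (λ w → ∣ nbrs R w ∣) u) deg≤0)) λ ()
  where
  open Relational R using (_~?_)
  nbr : 1 ≤ ∣ nbrs R u ∣
  nbr = subst (_≤ ∣ nbrs R u ∣) (∣⁅x⁆∣≡1 v) (p⊆q⇒∣p∣≤∣q∣ λ x∈ →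
    subst (_∈ˢ nbrs R u) (sym (x∈⁅y⁆⇒x≡y v x∈)) (∈-select⁺ (u ~?_) (clique u∈c v∈c u≢v)))

module CliqueCount (es : ErdősSós) where

  -- The (1+t)-cliques of a graph without the tree S on 2+a vertices: in the
  -- link of a vertex, S minus a leaf is missing, so induction on t applies.
  clique-bound : ∀ t a (S : Graph (2 + a)) → IsTree S →
    (R : Relational n) → ¬ Embeds R S →
    (W : Subset n) → (∀ {u v} → Relational._~_ R u v → u ∈ˢ W) →
    ∀ {cs} → Cliques R (1 + t) cs → All (_⊆ˢ W) cs →
    suc a * length cs ≤ ∣ W ∣ * (suc a C suc t)

  -- Each clique is counted at its `2 + t` vertices, and those at `v` become `1 + t`-cliques of the
  -- link, bounded in terms of the degree of `v`. Keeping the degree sum, instead of bounding it by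
  -- Erdős-Sós at once, yields the estimate per edge.
  clique-degree-bound : ∀ t a (S : Graph (3 + a)) → IsTree S →
    (R : Relational n) → ¬ Embeds R S →
    ∀ {cs} → Cliques R (2 + t) cs →
    suc a * ((2 + t) * length cs) ≤ degree-sum R * (suc a C suc t)

  -- Single vertices are cliques even when isolated, so here `cs⊆W` supplies the bound.
  clique-bound zero a S tree R ¬S W supp {cs} fam cs⊆W = begin
    suc a * length cs         ≤⟨ ℕ.*-monoʳ-≤ (suc a) (singletons-bound W cs cs-unique cs-uniform cs⊆W) ⟩
    suc a * ∣ W ∣             ≡⟨ ℕ.*-comm (suc a) ∣ W ∣ ⟩
    ∣ W ∣ * suc a             ≡⟨ cong (∣ W ∣ *_) (nC1≡n (suc a)) ⟨
    ∣ W ∣ * (suc a C 1)       ∎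
    where
    open ℕ.≤-Reasoning
    open Cliques fam
  -- `S` is a single edge, too small for `cone`; Erdős-Sós with `ℓ = 1` leaves no edges and hence no
  -- cliques.
  clique-bound (suc t) zero S tree R ¬S W supp {cs} fam cs⊆W =
    subst (λ l → 1 * l ≤ ∣ W ∣ * (1 C (2 + t))) (sym no-cs) z≤n
    where
    no-cs : length cs ≡ 0
    no-cs = no-cliques R (erdős-sós-degree-sum es 1 (s≤s z≤n) S tree R ¬S W supp) fam
  clique-bound (suc t) (suc a) S tree R ¬S W supp {cs} fam cs⊆W =
    -- The multiplier clears the denominator of the clique weight. Its factor `suc a` reappears as
    -- `ℓ ∸ 1` in Erdős-Sós, and `2 + t` through absorption.
    ℕ.*-cancelˡ-≤ (suc a * (2 + t)) {{ℕ.m*n≢0 (suc a) (2 + t)}} (begin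
    (suc a * (2 + t)) * ((2 + a) * length cs)
      ≡⟨ shuffle₁ (suc a) (2 + t) (2 + a) (length cs) ⟩
    (2 + a) * (suc a * ((2 + t) * length cs))
      ≤⟨ ℕ.*-monoʳ-≤ (2 + a) (clique-degree-bound t a S tree R ¬S fam) ⟩
    (2 + a) * (degree-sum R * (suc a C suc t))
      ≤⟨ ℕ.*-monoʳ-≤ (2 + a) (ℕ.*-monoˡ-≤ (suc a C suc t)
           (erdős-sós-degree-sum es (2 + a) (s≤s z≤n) S tree R ¬S W supp)) ⟩
    (2 + a) * ((suc a * ∣ W ∣) * (suc a C suc t))
      ≡⟨ shuffle₂ (2 + a) (suc a) ∣ W ∣ (suc a C suc t) ⟩
    (suc a * ∣ W ∣) * ((2 + a) * (suc a C suc t))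
      ≡⟨ cong ((suc a * ∣ W ∣) *_) ([1+r]*[1+n]C[1+r]≡[1+n]*nCr (suc a) (suc t)) ⟨
    (suc a * ∣ W ∣) * ((2 + t) * ((2 + a) C (2 + t)))
      ≡⟨ shuffle₃ (suc a) ∣ W ∣ (2 + t) ((2 + a) C (2 + t)) ⟩
    (suc a * (2 + t)) * (∣ W ∣ * ((2 + a) C (2 + t))) ∎)
    where
    open ℕ.≤-Reasoning
    shuffle₁ : ∀ x y z w → (x * y) * (z * w) ≡ z * (x * (y * w))
    shuffle₁ = solve-∀
    shuffle₂ : ∀ x y z w → x * ((y * z) * w) ≡ (y * z) * (x * w)
    shuffle₂ = solve-∀
    shuffle₃ : ∀ x y z w → (x * y) * (z * w) ≡ (x * z) * (y * w)
    shuffle₃ = solve-∀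

  clique-degree-bound {n} t a S tree R ¬S {cs} fam with prune S tree
  ... | x , conn , acyclic = begin
    suc a * ((2 + t) * length cs)
      ≡⟨ cong (suc a *_) (double-count cs (Cliques.cs-uniform fam)) ⟨
    suc a * sum (λ v → length (through v cs))
      ≡⟨ *-distribˡ-sum (suc a) (λ v → length (through v cs)) ⟩
    sum (λ v → suc a * length (through v cs))
      ≤⟨ sum-mono-≤ at-vertex ⟩
    sum (λ v → ∣ nbrs R v ∣ * (suc a C suc t))
      ≡⟨ *-distribʳ-sum (suc a C suc t) (λ v → ∣ nbrs R v ∣) ⟨
    degree-sum R * (suc a C suc t) ∎
    where
    open ℕ.≤-Reasoning
    open Relational R using (_~?_)
    at-vertex : ∀ v → suc a * length (through v cs) ≤ ∣ nbrs R v ∣ * (suc a C suc t)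
    at-vertex v = subst (λ l → suc a * l ≤ ∣ nbrs R v ∣ * (suc a C suc t))
      (length-map (_- v) (through v cs))
      (clique-bound t a (delete S x) (conn , acyclic) (link R v)
        (¬S ∘ cone R v S x conn) (nbrs R v) (λ (vu , _) → ∈-select⁺ (v ~?_) vu)
        (links-cliques R v fam) (links-⊆ R v fam))

-- The red–blue decomposition

Unique-++⁻ : {A : Set} (xs : List A) {ys : List A} → Unique (xs ++ ys) → Unique xs × Unique ys
Unique-++⁻ []       u        = [] , u
Unique-++⁻ (x ∷ xs) (x∉ ∷ u) =
  All.++⁻ˡ xs x∉ ∷ proj₁ (Unique-++⁻ xs u) , proj₂ (Unique-++⁻ xs u)

Unique-map-injective : {A B : Set} {f : A → B} {xs : List A} → Unique (map f xs) →
  ∀ {x y} → x ∈ xs → y ∈ xs → f x ≡ f y → x ≡ y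
Unique-map-injective (_ ∷ _)  (here refl) (here refl) _  = refl
Unique-map-injective {f = f} (x∉ ∷ _) (here refl) (there y∈) eq =
  contradiction eq (All.lookup x∉ (∈-map⁺ f y∈))
Unique-map-injective {f = f} (y∉ ∷ _) (there x∈) (here refl) eq =
  contradiction (sym eq) (All.lookup y∉ (∈-map⁺ f x∈))
Unique-map-injective (_ ∷ u)  (there x∈) (there y∈) eq = Unique-map-injective u x∈ y∈ eq

Covers : Subset n → Subset n → Set
Covers a b = ∣ b ∣ ≡ 2 × b ⊆ˢ a

escape : ∀ a (R : List (Subset n)) →
         (∃ λ b → Covers a b × ¬ b ∈ R) ⊎ (∀ {b} → Covers a b → b ∈ R)
escape a R
  with anySubset? (λ b → ((∣ b ∣ ℕ.≟ 2) ×-dec (b ⊆ˢ? a)) ×-dec ¬? (_∈?_ _≟ˢ_ b R))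
... | yes found = inj₁ found
... | no ¬found = inj₂ λ {b} ab → decidable-stable (_∈?_ _≟ˢ_ b R)
                    λ b∉R → ¬found (b , ab , b∉R)

module _ {n : ℕ} where
  open König {Subset n} {Subset n} _≟ˢ_ Covers escape public

-- Each edge of `F` goes to the hyperedge matched with its image pair. Distinct edges have distinct
-- image pairs, and `Unique (left M)` makes the matched hyperedges distinct too.
matching⇒berge :
  (F : Graph p) (H : Hypergraph r n) (M : List (Subset n × Subset n)) →
  Related M → Unique (left M) → (∀ {a} → a ∈ left M → a ∈ edges H) →
  (φ : Fin p → Fin n) → Injective _≡_ _≡_ φ →
  (∀ u v → Adj F u v → pair (φ u) (φ v) ∈ right M) →
  ContainsBerge F H
matching⇒berge {p} {r} {n} F H M rel uniq left⊆ φ φ-inj hom =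
  φ , φ-inj , f , f-injective , f-covers
  where
  record Match (e : E F) : Set where
    field
      u v       : Fin p
      ends      : edge F e ≡ pair u v
      a         : Subset n
      ∈M        : (a , pair (φ u) (φ v)) ∈ M
    a∈H : a ∈ edges H
    a∈H = left⊆ (∈-map⁺ proj₁ ∈M)

  match : ∀ e → Match e
  match e = record { u = u ; v = v ; ends = ends ; a = proj₁ (proj₁ found)
    ; ∈M = subst (λ b → (proj₁ (proj₁ found) , b) ∈ M) (sym (proj₂ (proj₂ found)))
             (proj₁ (proj₂ found)) }
    where
    e∈F = ∈-lookup {xs = edges F} e
    endpoints = ∣p∣≡2⇒pair (edge F e) (All.lookup (uniform F) e∈F)
    u = proj₁ endpoints
    v = proj₁ (proj₂ endpoints)
    ends = proj₂ (proj₂ (proj₂ endpoints))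
    found = ∈-map⁻ proj₂ (hom u v (subst (_∈ edges F) ends e∈F))

  f : E F → E H
  f e = index (Match.a∈H (match e))

  edge-f : ∀ e → edge H (f e) ≡ Match.a (match e)
  edge-f e = sym (lookup-index (Match.a∈H (match e)))

  f-injective : Injective _≡_ _≡_ f
  f-injective {e} {e′} eq = lookup-injective (unique F)
    (trans E₁.ends (trans (pair-cancel φ-inj (cong proj₂ same)) (sym E₂.ends)))
    where
    module E₁ = Match (match e)
    module E₂ = Match (match e′)
    same : (E₁.a , pair (φ E₁.u) (φ E₁.v)) ≡ (E₂.a , pair (φ E₂.u) (φ E₂.v))
    same = Unique-map-injective uniq E₁.∈M E₂.∈M
      (trans (sym (edge-f e)) (trans (cong (edge H) eq) (edge-f e′)))

  f-covers : ∀ e u v → edge F e ≡ pair u v → pair (φ u) (φ v) ⊆ˢ edge H (f e)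
  -- The given ends may be those chosen by `match` in the opposite order; the image pair is the
  -- same.
  f-covers e u v eq = subst₂ _⊆ˢ_
    (pair-cong φ (trans (sym ends) eq)) (sym (edge-f e))
    (proj₂ (All.lookup rel ∈M))
    where open Match (match e)

-- total has the red and the blue edges; cs are the hyperedges that are not
-- matched to a red edge.
record RedBlue (r n : ℕ) (F : Graph p) (H : Hypergraph r n) : Set where
  field
    total          : Graph n
    blue           : Graph n
    cs             : List (Subset n)
    red-size       : ℕ
    size-H         : size H ≡ red-size + length cs
    size-total     : size total ≡ red-size + size blue
    total-free     : ¬ ContainsSubgraph F total
    blue⊆total     : ∀ {u v} → Adj blue u v → Adj total u v
    cliques        : Cliques (relational blue) r cs

red-blue : (F : Graph p) (H : Hypergraph r n) → ¬ ContainsBerge F H → RedBlue r n F H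
red-blue {p} {r} {n} F H ¬berge = record
  { total = total ; blue = blue-graph
  ; cs = left blue ++ rest
  ; red-size = length red
  ; size-H = trans (↭-length cover) (trans (length-++ (left red))
      (cong (_+ length (left blue ++ rest)) (length-map proj₁ red)))
  ; size-total = trans (length-++ (right red)) (cong (_+ length (right blue)) (length-map proj₂ red))
  -- Blue edges are matched too, so `red ++ blue` is a single matching and a copy of `F` among its
  -- pairs would be a Berge copy.
  ; total-free = λ (φ , φ-inj , hom) → ¬berge
      (matching⇒berge F H (red ++ blue) (All.++⁺ red-rel blue-rel)
        (subst Unique (sym (map-++ proj₁ red blue)) left-unique)
        (λ a∈ → ∈-resp-↭ (↭-sym cover)
          (subst (_ ∈_) (++-assoc (left red) (left blue) rest)
            (∈-++⁺ˡ (subst (_ ∈_) (map-++ proj₁ red blue) a∈))))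
        φ φ-inj
        λ u v uv → subst (_ ∈_) (sym (map-++ proj₂ red blue)) (hom u v uv))
  ; blue⊆total = ∈-++⁺ʳ (right red)
  ; cliques = record
      { cs-unique = proj₂ (Unique-++⁻ (left red) cover-unique)
      ; cs-uniform = All.tabulate λ c∈ →
          All.lookup (uniform H) (∈-resp-↭ (↭-sym cover) (∈-++⁺ʳ (left red) c∈))
      -- König's cover enters here: a pair inside a hyperedge that is not red must be blue.
      ; cs-cliques = All.tabulate λ c∈ {u} {v} u∈ v∈ u≢v →
          closed c∈ (∣pair∣≡2 u≢v , pair-⊆ u∈ v∈) } }
  where
  open Decomposition (decompose (edges H))
  right-size : ∀ {M} → Related M → All (λ e → ∣ e ∣ ≡ 2) (right M)
  right-size rel = All.map⁺ (All.map proj₁ rel)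
  total blue-graph : Graph n
  total = mkHypergraph (right red ++ right blue) distinct
    (All.++⁺ (right-size red-rel) (right-size blue-rel))
  blue-graph = mkHypergraph (right blue) (proj₂ (Unique-++⁻ (right red) distinct))
    (right-size blue-rel)
  cover-unique : Unique (left red ++ left blue ++ rest)
  cover-unique = Unique-resp-↭ cover (unique H)
  left-unique : Unique (left red ++ left blue)
  left-unique = proj₁ (Unique-++⁻ (left red ++ left blue)
    (subst Unique (sym (++-assoc (left red) (left blue) rest)) cover-unique))

-- Upper bounds on the number of hyperedges

module UpperBound (es : ErdősSós) (T : Graph (suc k)) (tree : IsTree T) (1≤k : 1 ≤ k)
                  (H : Hypergraph r n) (¬berge : ¬ ContainsBerge T H) where

  open RedBlue (red-blue T H ¬berge) public

  blue-size cs-size : ℕ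
  blue-size = size blue
  cs-size   = length cs

  blue-free : ¬ Embeds (relational blue) T
  blue-free (φ , φ-inj , hom) = total-free (φ , φ-inj , λ u v uv → blue⊆total (hom u v uv))

  blue-degree : degree-sum (relational blue) ≤ 2 * blue-size
  blue-degree = degree-sum-≤ blue (relational blue) (λ uv → uv)

  total-bound : 2 * (red-size + blue-size) ≤ (k ∸ 1) * n
  total-bound = subst (λ s → 2 * s ≤ (k ∸ 1) * n) size-total
    (erdős-sós-size es k 1≤k T tree total total-free)

cliques-bound : (es : ErdősSós) → ∀ {a t} (T : Graph (3 + a)) (tree : IsTree T)
  (H : Hypergraph (2 + t) n) (¬berge : ¬ ContainsBerge T H) →
  let open UpperBound es T tree (s≤s z≤n) H ¬berge in
  suc a * ((2 + t) * cs-size) ≤ (2 * blue-size) * (suc a C suc t)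
cliques-bound es {a} {t} T tree H ¬berge =
  ℕ.≤-trans (CliqueCount.clique-degree-bound es t a T tree (relational blue) blue-free cliques)
            (ℕ.*-monoˡ-≤ (suc a C suc t) blue-degree)
  where open UpperBound es T tree (s≤s z≤n) H ¬berge

-- The clique weight of an edge is at least 1, so red edges may be charged at it as well. The charge
-- then depends only on the number of red and blue edges together, which Erdős-Sós bounds.
size-bound-large : ErdősSós → ∀ {a t} → 2 + t ≤ a → (T : Graph (3 + a)) → IsTree T →
  (H : Hypergraph (2 + t) n) → ¬ ContainsBerge T H →
  (2 + a) * size H ≤ n * ((2 + a) C (2 + t))
size-bound-large {n} es {a} {t} t≤a T tree H ¬berge =
  ℕ.*-cancelˡ-≤ (suc a * (2 + t)) {{ℕ.m*n≢0 (suc a) (2 + t)}} (begin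
  suc a * (2 + t) * ((2 + a) * size H)
    ≡⟨ cong (λ s → suc a * (2 + t) * ((2 + a) * s)) size-H ⟩
  suc a * (2 + t) * ((2 + a) * (red-size + cs-size))
    ≡⟨ shuffle₁ (suc a) (2 + t) (2 + a) red-size cs-size ⟩
  (2 + a) * (red-size * ((2 + t) * suc a) + suc a * ((2 + t) * cs-size))
    ≤⟨ ℕ.*-monoʳ-≤ (2 + a) (ℕ.+-mono-≤
         (ℕ.*-monoʳ-≤ red-size (r[k-1]≤2[k-1]C[r-1] a t t≤a))
         (cliques-bound es T tree H ¬berge)) ⟩
  (2 + a) * (red-size * (2 * c) + (2 * blue-size) * c)
    ≡⟨ shuffle₂ (2 + a) red-size blue-size c ⟩
  (2 * (red-size + blue-size)) * ((2 + a) * c)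
    ≤⟨ ℕ.*-monoˡ-≤ ((2 + a) * c) total-bound ⟩
  (suc a * n) * ((2 + a) * c)
    ≡⟨ cong ((suc a * n) *_) ([1+r]*[1+n]C[1+r]≡[1+n]*nCr (suc a) (suc t)) ⟨
  (suc a * n) * ((2 + t) * ((2 + a) C (2 + t)))
    ≡⟨ shuffle₃ (suc a) n (2 + t) ((2 + a) C (2 + t)) ⟩
  suc a * (2 + t) * (n * ((2 + a) C (2 + t))) ∎)
  where
  open UpperBound es T tree (s≤s z≤n) H ¬berge
  open ℕ.≤-Reasoning
  c = suc a C suc t
  shuffle₁ : ∀ x y z u v → x * y * (z * (u + v)) ≡ z * (u * (y * x) + x * (y * v))
  shuffle₁ = solve-∀
  shuffle₂ : ∀ z u v w → z * (u * (2 * w) + (2 * v) * w) ≡ (2 * (u + v)) * (z * w)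
  shuffle₂ = solve-∀
  shuffle₃ : ∀ x y z w → (x * y) * (z * w) ≡ x * z * (y * w)
  shuffle₃ = solve-∀

-- The clique weight is at most 1, so there are no more blue cliques than blue edges.
size-bound-small : ErdősSós → ∀ {k t} → 1 ≤ k → k ≤ 3 + t → (T : Graph (suc k)) → IsTree T →
  (H : Hypergraph (2 + t) n) → ¬ ContainsBerge T H →
  2 * size H ≤ (k ∸ 1) * n
size-bound-small {n} es {k} {t} 1≤k k≤r+1 T tree H ¬berge = begin
  2 * size H                       ≡⟨ cong (2 *_) size-H ⟩
  2 * (red-size + cs-size)         ≤⟨ ℕ.*-monoʳ-≤ 2 (ℕ.+-monoʳ-≤ red-size (cs≤blue 1≤k k≤r+1 T tree ¬berge)) ⟩
  2 * (red-size + blue-size)       ≤⟨ total-bound ⟩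
  (k ∸ 1) * n                      ∎
  where
  open UpperBound es T tree 1≤k H ¬berge
  open ℕ.≤-Reasoning
  cs≤blue : ∀ {k} (1≤k : 1 ≤ k) → k ≤ 3 + t → (T : Graph (suc k)) (tree : IsTree T)
    (¬berge : ¬ ContainsBerge T H) →
    let module U = UpperBound es T tree 1≤k H ¬berge in U.cs-size ≤ U.blue-size
  -- The weight has `k - 1` in its denominator, so `k = 1` is separate: `T` is a single edge and
  -- `total` has no edges at all.
  cs≤blue {suc zero} (s≤s z≤n) _ T tree ¬berge =
    ℕ.≤-trans (ℕ.≤-reflexive (no-cliques (relational U.blue) edgeless U.cliques)) z≤n
    where
    module U = UpperBound es T tree (s≤s z≤n) H ¬berge
    edgeless : degree-sum (relational U.blue) ≤ 0
    edgeless = ℕ.≤-trans U.blue-degree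
      (ℕ.≤-trans (ℕ.*-monoʳ-≤ 2 (ℕ.m≤n+m U.blue-size U.red-size)) U.total-bound)
  cs≤blue {suc (suc a)} (s≤s z≤n) (s≤s (s≤s a≤t)) T tree ¬berge =
    ℕ.*-cancelˡ-≤ ((2 + t) * suc a) (begin
    (2 + t) * suc a * U.cs-size       ≡⟨ shuffle₁ (2 + t) (suc a) U.cs-size ⟩
    suc a * ((2 + t) * U.cs-size)     ≤⟨ cliques-bound es T tree H ¬berge ⟩
    2 * U.blue-size * c               ≡⟨ shuffle₂ U.blue-size c ⟩
    2 * c * U.blue-size               ≤⟨ ℕ.*-monoˡ-≤ U.blue-size (2[k-1]C[r-1]≤r[k-1] a t a≤t) ⟩
    (2 + t) * suc a * U.blue-size     ∎)
    where
    module U = UpperBound es T tree (s≤s z≤n) H ¬berge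
    c = suc a C suc t
    shuffle₁ : ∀ x y z → x * y * z ≡ y * (x * z)
    shuffle₁ = solve-∀
    shuffle₂ : ∀ x y → 2 * x * y ≡ 2 * y * x
    shuffle₂ = solve-∀

-- Disjoint complete hypergraphs

∣++∣ : (x : Subset m) (y : Subset n) → ∣ x ++ᵛ y ∣ ≡ ∣ x ∣ + ∣ y ∣
∣++∣ []            y = refl
∣++∣ (inside  ∷ x) y = cong suc (∣++∣ x y)
∣++∣ (outside ∷ x) y = ∣++∣ x y

cliqueBlocks : (q k r : ℕ) → List (Subset (q * k))
cliqueBlocks zero    k r = []
cliqueBlocks (suc q) k r =
  map (_++ᵛ ⊥) (combinations k r) ++ map (⊥ ++ᵛ_) (cliqueBlocks q k r)

length-cliqueBlocks : ∀ q k r → length (cliqueBlocks q k r) ≡ q * (k C r)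
length-cliqueBlocks zero    k r = refl
length-cliqueBlocks (suc q) k r =
  trans (length-++ (map (_++ᵛ ⊥) (combinations k r)))
    (cong₂ _+_ (trans (length-map _ (combinations k r)) (length-combinations k r))
               (trans (length-map _ (cliqueBlocks q k r)) (length-cliqueBlocks q k r)))

cliqueBlocks-uniform : ∀ q k r → All (λ c → ∣ c ∣ ≡ r) (cliqueBlocks q k r)
cliqueBlocks-uniform zero    k r = []
cliqueBlocks-uniform (suc q) k r = All.++⁺
  (All.map⁺ (All.map
    (λ {c} c≡r → trans (∣++∣ c ⊥) (trans (cong₂ _+_ c≡r (∣⊥∣≡0 (q * k))) (ℕ.+-identityʳ r)))
    (combinations-uniform k r)))
  (All.map⁺ (All.map
    (λ {c} c≡r → trans (∣++∣ (⊥ {k}) c) (cong₂ _+_ (∣⊥∣≡0 k) c≡r))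
    (cliqueBlocks-uniform q k r)))

-- Positive uniformity keeps the blocks apart: the empty set would occur in each of them.
cliqueBlocks-unique : ∀ q k r → Unique (cliqueBlocks q k (suc r))
cliqueBlocks-unique zero    k r = []
cliqueBlocks-unique (suc q) k r = Unique.++⁺
  (Unique.map⁺ (λ {c} {d} → ++-injectiveˡ c d) (combinations-unique k (suc r)))
  (Unique.map⁺ (++-injectiveʳ (⊥ {k}) ⊥) (cliqueBlocks-unique q k r))
  λ (∈first , ∈rest) → disjoint (∈-map⁻ _ ∈first) (∈-map⁻ _ ∈rest)
  where
  disjoint : ∀ {e} → (∃ λ c → c ∈ combinations k (suc r) × e ≡ c ++ᵛ ⊥) →
             ¬ (∃ λ d → d ∈ cliqueBlocks q k (suc r) × e ≡ ⊥ ++ᵛ d)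
  disjoint (c , c∈ , refl) (d , _ , eq)
    with trans (sym (All.lookup (combinations-uniform k (suc r)) c∈))
           (trans (cong ∣_∣ (++-injectiveˡ c ⊥ eq)) (∣⊥∣≡0 k))
  ... | ()

quotient-first : (c : Subset k) {u : Fin (suc q * k)} → u ∈ˢ c ++ᵛ ⊥ →
                 quotient {suc q} k u ≡ zero
quotient-first {k} {q} c {u} u∈
  with splitAt k u | trans (sym (lookup-splitAt k c (⊥ {q * k}) u)) ([]=⇒lookup u∈)
... | inj₁ _ | _ = refl
... | inj₂ j | ⊥j≡inside with trans (sym (lookup-replicate j outside)) ⊥j≡inside
...   | ()

quotient-rest : (d : Subset (q * k)) {u : Fin (suc q * k)} → u ∈ˢ ⊥ {k} ++ᵛ d →
                ∃ λ j → j ∈ˢ d × quotient {suc q} k u ≡ suc (quotient {q} k j)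
quotient-rest {q} {k} d {u} u∈
  with splitAt k u | trans (sym (lookup-splitAt k (⊥ {k}) d u)) ([]=⇒lookup u∈)
... | inj₂ j | d-j = j , lookup⇒[]= j d d-j , refl
... | inj₁ i | ⊥i≡inside with trans (sym (lookup-replicate i outside)) ⊥i≡inside
...   | ()

same-block : ∀ q k r {c} → c ∈ cliqueBlocks q k r → ∀ {u v} → u ∈ˢ c → v ∈ˢ c →
             quotient {q} k u ≡ quotient {q} k v
same-block (suc q) k r {c} c∈ {u} {v} u∈ v∈
  with ∈-++⁻ (map (_++ᵛ ⊥) (combinations k r)) c∈
... | inj₁ ∈first with ∈-map⁻ (_++ᵛ ⊥) ∈first
...   | c′ , _ , refl = trans (quotient-first {q = q} c′ u∈) (sym (quotient-first {q = q} c′ v∈))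
same-block (suc q) k r {c} c∈ {u} {v} u∈ v∈
    | inj₂ ∈rest with ∈-map⁻ (⊥ ++ᵛ_) ∈rest
...   | d , d∈ , refl with quotient-rest {q} {k} d u∈ | quotient-rest {q} {k} d v∈
...     | i , i∈ , eqᵢ | j , j∈ , eqⱼ =
  trans eqᵢ (trans (cong suc (same-block q k r d∈ i∈ j∈)) (sym eqⱼ))

disjointCliques : ∀ q k r → Hypergraph (suc r) (q * k)
disjointCliques q k r = mkHypergraph (cliqueBlocks q k (suc r))
  (cliqueBlocks-unique q k r) (cliqueBlocks-uniform q k (suc r))

-- Hyperedges stay inside one block, so a connected `T` would map into a single block, and its
-- `suc k` vertices would need distinct remainders among `k`.
disjointCliques-free : ∀ q k r (T : Graph (suc k)) → Connected T →
                       ¬ ContainsBerge T (disjointCliques q k r)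
disjointCliques-free q k r T conn (φ , φ-inj , f , _ , covers) =
  ℕ.<-irrefl refl (injective⇒≤ remainder-inj)
  where
  H = disjointCliques q k r
  block : Fin (q * k) → Fin q
  block = quotient {q} k
  step : ∀ {u v} → Adj T u v → block (φ u) ≡ block (φ v)
  step {u} {v} uv = same-block q k (suc r) (∈-lookup {xs = edges H} (f e))
    (covered (∈-pairˡ _ _)) (covered (∈-pairʳ _ _))
    where
    e = index uv
    covered = covers e u v (sym (lookup-index uv))
  walk : ∀ {u v} → Star (Adj T) u v → block (φ u) ≡ block (φ v)
  walk ε          = refl
  walk (uw ◅ rest) = trans (step uw) (walk rest)
  remainder-inj : Injective _≡_ _≡_ (remainder {q} k ∘ φ)
  remainder-inj {u} {v} eq = φ-inj (begin
    φ u                                     ≡⟨ combine-remQuot {q} k (φ u) ⟨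
    uncurry combine (remQuot {q} k (φ u))   ≡⟨ cong₂ combine (walk (conn u v)) eq ⟩
    uncurry combine (remQuot {q} k (φ v))   ≡⟨ combine-remQuot {q} k (φ v) ⟩
    φ v                                     ∎)
    where open ≡-Reasoning

-- Extremal numbers

empty : Hypergraph r n
empty = mkHypergraph [] [] []

-- `T` has an edge, which needs a hyperedge. This ensures that `exBerge` is attained by a hypergraph
-- and is not its default value 0.
empty-free : ∀ {k} → 1 ≤ k → (T : Graph (suc k)) → Connected T →
             ¬ ContainsBerge T (empty {r} {n})
empty-free (s≤s z≤n) T conn (_ , _ , f , _) =
  ¬Fin0 (f (index (proj₂ (connected-neighbour T conn zero))))

exBerge-attained : ∀ r n {k} → 1 ≤ k → (T : Graph (suc k)) → IsTree T →
  ∃ λ (H : Hypergraph r n) → size H ≡ exBerge r n T × ¬ ContainsBerge T H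
exBerge-attained r n 1≤k T (conn , _) =
  BergeTurán.ex-attained r n T empty (empty-free {r} {n} 1≤k T conn)

exBerge-≥ : ∀ r q {k} (T : Graph (suc k)) → IsTree T →
            q * (k C suc r) ≤ exBerge (suc r) (q * k) T
exBerge-≥ r q {k} T (conn , _) =
  subst (_≤ exBerge (suc r) (q * k) T) (length-cliqueBlocks q k (suc r))
    (BergeTurán.ex-max (suc r) (q * k) T (disjointCliques q k r)
      (disjointCliques-free q k r T conn))

module _ (es : ErdősSós) (n : ℕ) where

  exBerge-large : ∀ {k t} → 2 + t + 1 < k → (T : Graph (suc k)) → IsTree T →
                  k * exBerge (2 + t) n T ≤ n * (k C (2 + t))
  exBerge-large {suc (suc a)} {t} (s≤s (s≤s t<a)) T tree =
    subst (λ s → (2 + a) * s ≤ n * ((2 + a) C (2 + t))) size≡ex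
      (size-bound-large es (subst (_≤ a) (cong suc (ℕ.+-comm t 1)) t<a) T tree
        (proj₁ attained) (proj₂ (proj₂ attained)))
    where
    attained = exBerge-attained (2 + t) n (s≤s z≤n) T tree
    size≡ex = proj₁ (proj₂ attained)

  exBerge-small : ∀ {k t} → 1 ≤ k → k ≤ 2 + t + 1 → (T : Graph (suc k)) → IsTree T →
                  2 * exBerge (2 + t) n T ≤ (k ∸ 1) * n
  exBerge-small {k} {t} 1≤k k≤ T tree =
    subst (λ s → 2 * s ≤ (k ∸ 1) * n) size≡ex
      (size-bound-small es 1≤k (subst (k ≤_) (ℕ.+-comm (2 + t) 1) k≤) T tree
        (proj₁ attained) (proj₂ (proj₂ attained)))
    where
    attained = exBerge-attained (2 + t) n 1≤k T tree
    size≡ex = proj₁ (proj₂ attained)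

theorem7 :
    ErdősSós →
    ∀ (k r : ℕ) → 1 ≤ k → 2 ≤ r →
    (T : Graph (suc k)) → IsTree T →
    ∀ (n : ℕ) → 1 ≤ n →
    (r + 1 < k → 3 < r + 1 →
      (k * exBerge r n T ≤ n * (k C r)) ×
      (k ∣ n → k * exBerge r n T ≡ n * (k C r))) ×
    (k ≤ r + 1 → 2 * exBerge r n T ≤ (k ∸ 1) * n)
theorem7 es k r@(suc (suc t)) 1≤k (s≤s (s≤s z≤n)) T tree n 1≤n =
  (λ r+1<k _ → exBerge-large es n r+1<k T tree ,
    -- Here `n` becomes `q * k`, and `q` disjoint complete hypergraphs on `k` vertices give the
    -- lower bound.
    λ { (divides q refl) → ℕ.≤-antisym (exBerge-large es n r+1<k T tree) (begin
      (q * k) * (k C r)        ≡⟨ cong (_* (k C r)) (ℕ.*-comm q k) ⟩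
      (k * q) * (k C r)        ≡⟨ ℕ.*-assoc k q (k C r) ⟩
      k * (q * (k C r))        ≤⟨ ℕ.*-monoʳ-≤ k (exBerge-≥ (suc t) q T tree) ⟩
      k * exBerge r (q * k) T  ∎) }) ,
  λ k≤r+1 → exBerge-small es n 1≤k k≤r+1 T tree
  where open ℕ.≤-Reasoning
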